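{- There is a polynomial-space algorithm that, given a graph $G$ of order $n$, enumerates all minimal Roman dominating functions of $G$ with polynomial delay and in time $\mathcal{O}^*(1.9332^n)$.
   Context: Graphs are finite, undirected and simple; the order of a graph is its number of vertices. For a graph $G=(V,E)$, a function $f\colon V\to\{0,1,2\}$ is a Roman dominating function (rdf) if every $v$ with $f(v)=0$ has a neighbor $u$ with $f(u)=2$. $f\le g$ means $f(v)\le g(v)$ for all $v\in V$ (with $0<1<2$); an rdf $f$ is minimal if there is no rdf $g\ne f$ with $g\le f$. Enumerating means outputting all minimal rdf of the input graph, without repetitions. Polynomial delay means that there is a polynomial $p$ such that, on graphs of order $n$, at most $p(n)$ time elapses before the first output, between any two consecutive outputs, and between the last output and termination. Polynomial space means that the working memory used is bounded by a polynomial in $n$ (outputs are not stored). $\mathcal{O}^*$ suppresses factors polynomial in $n$. -}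

module Defs where

open import Data.Bool.Base using (Bool; true; false)
open import Data.Fin.Base as Fin using (Fin; toℕ)
open import Data.Fin.Patterns using (0F; 2F)
open import Data.List.Base as List using (List; []; _∷_; map; tabulate)
open import Data.List.Membership.Propositional using (_∈_)
open import Data.List.Relation.Unary.All using (All)
open import Data.List.Relation.Unary.Unique.Propositional using (Unique)
open import Data.Nat.Base using (ℕ; zero; suc; _+_; _*_; _^_; _⊔_; _≤_)
open import Data.Nat.ListAction using (sum)
open import Data.Product.Base using (_×_; _,_; ∃-syntax; proj₁; proj₂)
open import Data.Vec.Base as Vec using (Vec; lookup; replicate; _[_]≔_)
open import Function.Bundles using (_⇔_)
open import Relation.Binary.PropositionalEquality using (_≡_; _≗_)
open import Relation.Nullary using (¬_)

record Graph (n : ℕ) : Set where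
  field
    adj    : Fin n → Fin n → Bool
    sym    : ∀ u v → adj u v ≡ adj v u
    irrefl : ∀ v → adj v v ≡ false

  Adjacent : Fin n → Fin n → Set
  Adjacent u v = adj u v ≡ true

Labelling : ℕ → Set
Labelling n = Fin n → Fin 3

infix 4 _≼_

_≼_ : ∀ {n} → Labelling n → Labelling n → Set
f ≼ g = ∀ v → f v Fin.≤ g v

IsRDF : ∀ {n} → Graph n → Labelling n → Set
IsRDF G f = ∀ v → f v ≡ 0F → ∃[ u ] (Graph.Adjacent G v u × f u ≡ 2F)

IsMinimalRDF : ∀ {n} → Graph n → Labelling n → Set
IsMinimalRDF G f =
  IsRDF G f × ¬ (∃[ g ] (IsRDF G g × ¬ (g ≗ f) × g ≼ f))

-- The model of computation: Jones's WHILE language over binary trees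
-- (LISP data with a single atom), extended by a write-only output.
data Tree : Set where
  nil  : Tree
  cons : Tree → Tree → Tree

size : Tree → ℕ
size nil        = 1
size (cons s t) = suc (size s + size t)

data Expr (k : ℕ) : Set where
  var   : Fin k → Expr k
  nil   : Expr k
  cons  : Expr k → Expr k → Expr k
  hd tl : Expr k → Expr k

infix  6 _≔_
infixr 5 _⨾_

data Cmd (k : ℕ) : Set where
  _≔_           : Fin k → Expr k → Cmd k
  _⨾_           : Cmd k → Cmd k → Cmd k
  if_then_else_ : Expr k → Cmd k → Cmd k → Cmd k
  while_loop_   : Expr k → Cmd k → Cmd k
  output        : Expr k → Cmd k

Store : ℕ → Set
Store k = Vec Tree k

head tail : Tree → Tree
head nil        = nil
head (cons s t) = s
tail nil        = nil
tail (cons s t) = t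

eval : ∀ {k} → Expr k → Store k → Tree
eval (var x)    σ = lookup σ x
eval nil        σ = nil
eval (cons d e) σ = cons (eval d σ) (eval e σ)
eval (hd e)     σ = head (eval e σ)
eval (tl e)     σ = tail (eval e σ)

-- Every tree operation takes one unit of time, as for pointers to
-- shared, immutable cells.
evalTime : ∀ {k} → Expr k → ℕ
evalTime (var x)    = 1
evalTime nil        = 1
evalTime (cons d e) = suc (evalTime d + evalTime e)
evalTime (hd e)     = suc (evalTime e)
evalTime (tl e)     = suc (evalTime e)

-- nil is false, every other tree is true.
branch : ∀ {A : Set} → Tree → A → A → A
branch nil        _ y = y
branch (cons _ _) x _ = x

-- Memory in use, counting shared subtrees once for each occurrence, so
-- that no implementation with sharing uses more.  Temporaries arising
-- in the evaluation of an expression, and the control stack of a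
-- `Config`, add only a factor and a summand depending on the program.
space : ∀ {k} → Store k → ℕ
space σ = Vec.sum (Vec.map size σ)

-- The commands still to be executed, and the store.
Config : ℕ → Set
Config k = List (Cmd k) × Store k

-- What is observed of a terminating execution: the time until the first
-- output (or until termination, if there is none); the outputs, each
-- with the time from it to the next output or, for the last one, to
-- termination; and the maximum of `space` over all configurations.
record Run : Set where
  constructor run
  field
    firstGap : ℕ
    emitted  : List (Tree × ℕ)
    peak     : ℕ

  outputs : List Tree
  outputs = map proj₁ emitted

  gaps : List ℕ
  gaps = firstGap ∷ map proj₂ emitted

  time : ℕ
  time = sum gaps

open Run public

silently : ℕ → ℕ → Run → Run
silently t s (run d os p) = run (t + d) os (s ⊔ p)

emitting : Tree → ℕ → ℕ → Run → Run
emitting v t s (run d os p) = run t ((v , d) ∷ os) (s ⊔ p)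

infix 4 _⇓_

data _⇓_ {k : ℕ} : Config k → Run → Set where

  halt : ∀ {σ} →
    ([] , σ) ⇓ run 0 [] (space σ)

  assign : ∀ {x e K σ r} →
    (K , σ [ x ]≔ eval e σ) ⇓ r →
    (x ≔ e ∷ K , σ) ⇓ silently (suc (evalTime e)) (space σ) r

  seq : ∀ {c d K σ r} →
    (c ∷ d ∷ K , σ) ⇓ r →
    ((c ⨾ d) ∷ K , σ) ⇓ silently 1 (space σ) r

  cond : ∀ {e c d K σ r} →
    (branch (eval e σ) c d ∷ K , σ) ⇓ r →
    ((if e then c else d) ∷ K , σ) ⇓ silently (suc (evalTime e)) (space σ) r

  loop : ∀ {e c K σ r} →
    (branch (eval e σ) (c ∷ (while e loop c) ∷ K) K , σ) ⇓ r →
    ((while e loop c) ∷ K , σ) ⇓ silently (suc (evalTime e)) (space σ) r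

  -- Writing a tree takes time proportional to its size.
  emit : ∀ {e K σ r} →
    (K , σ) ⇓ r →
    (output e ∷ K , σ) ⇓
      emitting (eval e σ) (evalTime e + size (eval e σ)) (space σ) r

-- A program with k work variables; variable zero holds the input.
Program : ℕ → Set
Program k = Cmd (suc k)

start : ∀ {k} → Program k → Tree → Config (suc k)
start {k} A t = A ∷ [] , t Vec.∷ replicate k nil

encodeList : List Tree → Tree
encodeList = List.foldr cons nil

encodeBool : Bool → Tree
encodeBool false = nil
encodeBool true  = cons nil nil

encodeℕ : ℕ → Tree
encodeℕ zero    = nil
encodeℕ (suc m) = cons nil (encodeℕ m)

-- The adjacency matrix, as the list of its rows.
encodeGraph : ∀ {n} → Graph n → Tree
encodeGraph G =
  encodeList (tabulate λ u →
    encodeList (tabulate λ v → encodeBool (Graph.adj G u v)))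

encodeLabelling : ∀ {n} → Labelling n → Tree
encodeLabelling f = encodeList (tabulate λ v → encodeℕ (toℕ (f v)))

-- Coefficients, constant term first.  Natural coefficients suffice, as
-- polynomials only serve as upper bounds at natural arguments.
Polynomial : Set
Polynomial = List ℕ

⟦_⟧ : Polynomial → ℕ → ℕ
⟦ [] ⟧    n = 0
⟦ a ∷ p ⟧ n = a + n * ⟦ p ⟧ n

_onGraph_⇓_ : ∀ {k n} → Program k → Graph n → Run → Set
A onGraph G ⇓ r = start A (encodeGraph G) ⇓ r

EnumeratesMinimalRDFs : ∀ {k} → Program k → Set
EnumeratesMinimalRDFs A =
  ∀ n (G : Graph n) → ∃[ r ]
    ( A onGraph G ⇓ r
    × Unique (outputs r)
    × (∀ t → t ∈ outputs r ⇔ (∃[ f ] (IsMinimalRDF G f × t ≡ encodeLabelling f))))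

-- Execution is deterministic, so the following definitions, which
-- quantify over all r, concern the one run of A on G.

PolynomialSpace : ∀ {k} → Program k → Set
PolynomialSpace A =
  ∃[ p ] ∀ n (G : Graph n) r → A onGraph G ⇓ r → peak r ≤ ⟦ p ⟧ n

PolynomialDelay : ∀ {k} → Program k → Set
PolynomialDelay A =
  ∃[ p ] ∀ n (G : Graph n) r → A onGraph G ⇓ r → All (_≤ ⟦ p ⟧ n) (gaps r)

-- Running time O*((a/b)ⁿ), with denominators cleared.
RunsInTimeO* : ∀ {k} → Program k → (a b : ℕ) → Set
RunsInTimeO* A a b =
  ∃[ p ] ∀ n (G : Graph n) r → A onGraph G ⇓ r →
    time r * b ^ n ≤ ⟦ p ⟧ n * a ^ n

-- A minimal Roman dominating function f is determined by the set S of vertices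
-- labelled 2, and the sets that occur are those in which every v ∈ S has an
-- external private neighbour: some x ∉ S whose only neighbour in S is v.  This
-- property is hereditary.  Hence, in a search deciding one vertex after the
-- other, every partial choice that passes the test extends by leaving out the
-- remaining vertices, so the delay is polynomial, and the lexicographic successor
-- can be computed from S alone, so the space is polynomial.
--
-- The running time is then governed by the number of such sets, bounded by
-- branching over pairs (U , C) of the vertices that may still be selected and
-- those that may still serve as private neighbours.  A vertex in both has weight
-- c = 1.9332, in U only 1.5521 ≈ c^(2/3), in C only 1.2886, otherwise 1; the
-- number of sets is at most the product of the weights.  The tight cases are the
-- branching on a vertex of U ∩ C with two neighbours in C, which forces
-- c³ ≥ 1.2886 c² + 1.5521², and an isolated edge between U and C, which forces
-- 1.5521 · 1.2886 ≥ 2.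
{-# OPTIONS --safe #-}
module Submission where

open import Defs
open import Data.Bool.Base using (Bool; true; false; not; _∧_; _∨_; T)
open import Data.Bool.Properties as Bool using (¬-not; ⇔→≡)
open import Data.Empty using (⊥; ⊥-elim)
open import Data.Fin using (#_)
open import Data.Fin.Base as Fin using (Fin; zero; suc; toℕ)
open import Data.Fin.Patterns using (0F; 1F; 2F)
open import Data.Fin.Properties using (_≟_; any?; suc-injective; toℕ-injective)
open import Data.List.Base as List using (List; []; _∷_; map; length; filter; _++_; tabulate; _ʳ++_; reverse)
open import Data.List.Membership.Propositional using (_∈_)
open import Data.List.Membership.Propositional.Properties using (∈-++⁺ˡ; ∈-++⁺ʳ; ∈-++⁻; ∈-map⁺; ∈-map⁻)
open import Data.List.Properties using (length-map; length-reverse; length-tabulate; map-++; reverse-involutive; ++-assoc; ++-identityʳ)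
open import Data.List.Relation.Unary.All as All using (All; []; _∷_)
import Data.List.Relation.Unary.All.Properties as All
open import Data.List.Relation.Unary.AllPairs as AllPairs using (AllPairs; []; _∷_)
import Data.List.Relation.Unary.AllPairs.Properties as AllPairs
open import Data.List.Relation.Unary.Any using (Any; here; there)
open import Data.List.Relation.Unary.Unique.Propositional using (Unique)
import Data.List.Relation.Unary.Unique.Propositional.Properties as Unique
open import Data.Nat.Base
open import Data.Nat.Induction using (<-wellFounded)
open import Data.Nat.ListAction using (sum)
open import Data.Nat.Properties hiding (_≟_; suc-injective)
open import Data.Nat.Solver using (module +-*-Solver)
open import Data.Product.Base using (_×_; _,_; Σ-syntax; ∃-syntax; proj₁; proj₂)
open import Data.Sum.Base as Sum using (_⊎_; inj₁; inj₂)
open import Data.Unit.Base using (⊤; tt)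
open import Data.Vec.Base as Vec using (Vec; lookup; _[_]≔_)
import Data.Vec.Properties as Vec
open import Function.Base using (_∘_)
open import Function.Bundles using (_⇔_; mk⇔)
open import Induction.WellFounded using (Acc) renaming (acc to accessible)
open import Relation.Binary.PropositionalEquality hiding ([_])
open import Relation.Nullary using (¬_; Dec; yes; no; does; ¬?; _×-dec_; contradiction)
open import Relation.Nullary.Decidable using (decidable-stable; dec-true; dec-false)

open +-*-Solver using (solve; _:*_; _:+_; _:=_; con)

-- Counting

-- Requirements of vertices already decided would not fit into a state (U , C), so they are
-- forgotten: `Good U C S` looks at S on U alone, and a decided vertex survives only through the
-- candidates that it removes from C. This can only admit more sets, so upper bounds stay valid, and
-- W serves both as the bound and as the measure of the recursion. All fractions are cleared to
-- natural numbers, so that each branching comes down to one comparison of closed numbers, decided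
-- by computation. On the machine, the time of silent steps also bounds the growth of the largest
-- tree. Each wait for an output passes through stores of known size, so the estimate of the time
-- between outputs yields the memory bound as well.

Sub : ℕ → Set
Sub n = Fin n → Bool

infix 4 _∋_
_∋_ : ∀ {n} → Sub n → Fin n → Set
U ∋ v = U v ≡ true

infixl 6 _-_
_-_ : ∀ {n} → Sub n → Fin n → Sub n
(U - v) i = not (does (i ≟ v)) ∧ U i

module _ {n} {U : Sub n} where

  -∌ : ∀ v → (U - v) v ≡ false
  -∌ v with v ≟ v
  ... | yes _  = refl
  ... | no v≢v = contradiction refl v≢v

  -≢ : ∀ {v i} → i ≢ v → (U - v) i ≡ U i
  -≢ {v} {i} i≢v with i ≟ v
  ... | yes i≡v = contradiction i≡v i≢v
  ... | no _    = refl

  -∋ : ∀ {v i} → U - v ∋ i → U ∋ i × i ≢ v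
  -∋ {v} {i} p with i ≟ v
  ... | no i≢v = p , i≢v

  ∋- : ∀ {v i} → U ∋ i → i ≢ v → U - v ∋ i
  ∋- p i≢v = trans (-≢ i≢v) p

∏ : ∀ {n} → (Fin n → ℕ) → ℕ
∏ {zero}  f = 1
∏ {suc n} f = f zero * ∏ (f ∘ suc)

∏-cong : ∀ {n} {f g : Fin n → ℕ} → f ≗ g → ∏ f ≡ ∏ g
∏-cong {zero}  f≗g = refl
∏-cong {suc n} f≗g = cong₂ _*_ (f≗g zero) (∏-cong (f≗g ∘ suc))

∏-const : ∀ n {a} → ∏ {n} (λ _ → a) ≡ a ^ n
∏-const zero    = refl
∏-const (suc n) {a} = cong (a *_) (∏-const n)

∏-mono : ∀ {n} {f g : Fin n → ℕ} → (∀ i → f i ≤ g i) → ∏ f ≤ ∏ g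
∏-mono {zero}  f≤g = ≤-refl
∏-mono {suc n} f≤g = *-mono-≤ (f≤g zero) (∏-mono (f≤g ∘ suc))

-- The quotient of two products that differ in one factor, cross-multiplied to stay in ℕ.
∏-update : ∀ {n} {f g : Fin n → ℕ} v → (∀ i → i ≢ v → f i ≡ g i) →
           ∏ f * g v ≡ ∏ g * f v
∏-update {suc n} {f} {g} zero f≈g
  rewrite ∏-cong {f = f ∘ suc} {g = g ∘ suc} (λ i → f≈g (suc i) (λ ())) =
  solve 3 (λ a b p → (a :* p) :* b := (b :* p) :* a) refl (f zero) (g zero) (∏ (g ∘ suc))
∏-update {suc n} {f} {g} (suc v) f≈g
  rewrite f≈g zero (λ ()) = begin
  g zero * ∏ (f ∘ suc) * g (suc v)    ≡⟨ *-assoc (g zero) _ _ ⟩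
  g zero * (∏ (f ∘ suc) * g (suc v))
    ≡⟨ cong (g zero *_) (∏-update v (λ i i≢v → f≈g (suc i) (i≢v ∘ suc-injective))) ⟩
  g zero * (∏ (g ∘ suc) * f (suc v))  ≡⟨ *-assoc (g zero) _ _ ⟨
  g zero * ∏ (g ∘ suc) * f (suc v)    ∎
  where open ≡-Reasoning

-- With weights u for `U` only, 2/u for `C` only and c for both, the first tight case reads c³ =
-- 2c²/u + u². The least c is attained at u³ = c², where c⁵ = 27, so c = 3^(3/5) ≈ 1.93318. The
-- four-decimal values, scaled by 10000, are chosen so that both tight inequalities hold.
weight : (selectable private? : Bool) → ℕ
weight false false = 10000
weight false true  = 12886
weight true  false = 15521
weight true  true  = 19332

weight≥10000 : ∀ b b′ → 10000 ≤ weight b b′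
weight≥10000 false false = ≤ᵇ⇒≤ _ _ tt
weight≥10000 false true  = ≤ᵇ⇒≤ _ _ tt
weight≥10000 true  false = ≤ᵇ⇒≤ _ _ tt
weight≥10000 true  true  = ≤ᵇ⇒≤ _ _ tt

-- The fraction w′/w is at most q/p. A record rather than the bare inequality, so that unification
-- can recover the four numbers: the branchings below leave theirs as `_`.
record Ratio (w′ w p q : ℕ) : Set where
  constructor cleared
  field clear : w′ * p ≤ w * q

open Ratio

ratio-trans : ∀ {w₀ w₁ w₂ p₁ q₁ p₂ q₂} →
  Ratio w₁ w₀ p₁ q₁ → Ratio w₂ w₁ p₂ q₂ → Ratio w₂ w₀ (p₁ * p₂) (q₁ * q₂)
ratio-trans {w₀} {w₁} {w₂} {p₁} {q₁} {p₂} {q₂} (cleared r₁) (cleared r₂) = cleared (begin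
  w₂ * (p₁ * p₂)  ≡⟨ solve 3 (λ a b d → a :* (b :* d) := (a :* d) :* b) refl w₂ p₁ p₂ ⟩
  w₂ * p₂ * p₁    ≤⟨ *-monoˡ-≤ p₁ r₂ ⟩
  w₁ * q₂ * p₁    ≡⟨ solve 3 (λ a b d → (a :* b) :* d := (a :* d) :* b) refl w₁ q₂ p₁ ⟩
  w₁ * p₁ * q₂    ≤⟨ *-monoˡ-≤ q₂ r₁ ⟩
  w₀ * q₁ * q₂    ≡⟨ *-assoc w₀ q₁ q₂ ⟩
  w₀ * (q₁ * q₂)  ∎)
  where open ≤-Reasoning

ratio-weaken : ∀ {w′ w} p q p′ q′ .{{_ : NonZero p}} → T (q * p′ ≤ᵇ p * q′) →
               Ratio w′ w p q → Ratio w′ w p′ q′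
ratio-weaken {w′} {w} p q p′ q′ qp′≤pq′ (cleared r) = cleared (*-cancelʳ-≤ _ _ p (begin
  w′ * p′ * p    ≡⟨ solve 3 (λ a b d → (a :* b) :* d := (a :* d) :* b) refl w′ p′ p ⟩
  w′ * p * p′    ≤⟨ *-monoˡ-≤ p′ r ⟩
  w * q * p′     ≡⟨ *-assoc w q p′ ⟩
  w * (q * p′)   ≤⟨ *-monoʳ-≤ w (≤ᵇ⇒≤ _ _ qp′≤pq′) ⟩
  w * (p * q′)   ≡⟨ solve 3 (λ a b d → a :* (b :* d) := (a :* d) :* b) refl w p q′ ⟩
  w * q′ * p     ∎))
  where open ≤-Reasoning

opaque

  -- Opaque, so that `W U C` is matched argument by argument when ratios are composed, and never
  -- unfolds into a product.
  W : ∀ {n} → Sub n → Sub n → ℕ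
  W U C = ∏ λ i → weight (U i) (C i)

  W-full : ∀ n → W {n} (λ _ → true) (λ _ → true) ≡ 19332 ^ n
  W-full n = ∏-const n

  10000ⁿ≤W : ∀ {n} (U C : Sub n) → 10000 ^ n ≤ W U C
  10000ⁿ≤W {n} U C = ≤-trans (≤-reflexive (sym (∏-const n)))
    (∏-mono λ i → weight≥10000 (U i) (C i))

module _ {n} {U C : Sub n} {v : Fin n} where

  opaque
    unfolding W

    deleteU-≡ : W (U - v) C * weight (U v) (C v) ≡ W U C * weight false (C v)
    deleteU-≡ = trans
      (∏-update {f = λ i → weight ((U - v) i) (C i)} v
        λ i i≢v → cong (λ b → weight b (C i)) (-≢ {U = U} i≢v))
      (cong (λ b → W U C * weight b (C v)) (-∌ {U = U} v))

    deleteC-≡ : W U (C - v) * weight (U v) (C v) ≡ W U C * weight (U v) false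
    deleteC-≡ = trans
      (∏-update {f = λ i → weight (U i) ((C - v) i)} v
        λ i i≢v → cong (weight (U i)) (-≢ {U = C} i≢v))
      (cong (λ b → W U C * weight (U v) b) (-∌ {U = C} v))

    deleteBoth-≡ : W (U - v) (C - v) * weight (U v) (C v) ≡ W U C * weight false false
    deleteBoth-≡ = trans
      (∏-update {f = λ i → weight ((U - v) i) ((C - v) i)} v
        λ i i≢v → cong₂ weight (-≢ {U = U} i≢v) (-≢ {U = C} i≢v))
      (cong₂ (λ b b′ → W U C * weight b b′) (-∌ {U = U} v) (-∌ {U = C} v))

  -- The ratio for v in U only is no worse, because 1.9332 ≤ 1.5521 · 1.2886;
  -- likewise in deleteC.
  deleteU : U ∋ v → Ratio (W (U - v) C) (W U C) 19332 12886
  deleteU Uv with U v | C v | deleteU-≡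
  deleteU refl | true | true  | eq = cleared (≤-reflexive eq)
  deleteU refl | true | false | eq = ratio-weaken 15521 10000 19332 12886 tt (cleared (≤-reflexive eq))

  deleteU-only : U ∋ v → C v ≡ false → Ratio (W (U - v) C) (W U C) 15521 10000
  deleteU-only Uv Cv with U v | C v | deleteU-≡
  deleteU-only refl refl | true | false | eq = cleared (≤-reflexive eq)

  deleteC : C ∋ v → Ratio (W U (C - v)) (W U C) 19332 15521
  deleteC Cv with U v | C v | deleteC-≡
  deleteC refl | true  | true | eq = cleared (≤-reflexive eq)
  deleteC refl | false | true | eq = ratio-weaken 12886 10000 19332 15521 tt (cleared (≤-reflexive eq))

  deleteC-only : C ∋ v → U v ≡ false → Ratio (W U (C - v)) (W U C) 12886 10000
  deleteC-only Cv Uv with U v | C v | deleteC-≡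
  deleteC-only refl refl | false | true | eq = cleared (≤-reflexive eq)

  deleteBoth : U ∋ v → C ∋ v → Ratio (W (U - v) (C - v)) (W U C) 19332 10000
  deleteBoth Uv Cv with U v | C v | deleteBoth-≡
  deleteBoth refl refl | true | true | eq = cleared (≤-reflexive eq)

W-nonZero : ∀ {n} (U C : Sub n) → NonZero (W U C)
W-nonZero {n} U C = >-nonZero (≤-trans (m^n>0 10000 n) (10000ⁿ≤W U C))

-- The sum of the fractions q/p over the product of their denominators; the denominator is the first
-- component.
total : List (ℕ × ℕ) → ℕ × ℕ
total []             = 1 , 0
total ((p , q) ∷ rs) = p * proj₁ (total rs) , q * proj₁ (total rs) + p * proj₂ (total rs)

AtMostOne : List (ℕ × ℕ) → Set
AtMostOne rs = T (proj₂ (total rs) ≤ᵇ proj₁ (total rs))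

filter-split : ∀ {A : Set} {P : A → Set} (P? : ∀ x → Dec (P x)) xs →
  length xs ≡ length (filter P? xs) + length (filter (¬? ∘ P?) xs)
filter-split P? []       = refl
filter-split P? (x ∷ xs) with does (P? x)
... | true  = cong suc (filter-split P? xs)
... | false = trans (cong suc (filter-split P? xs)) (sym (+-suc _ _))

allPairs-mapWith : ∀ {A : Set} {P : A → Set} {R S : A → A → Set} →
  (∀ {x y} → P x → P y → R x y → S x y) → ∀ {xs} → All P xs → AllPairs R xs → AllPairs S xs
allPairs-mapWith f []         []         = []
allPairs-mapWith f (px ∷ pxs) (rx ∷ rxs) =
  All.zipWith (λ (py , r) → f px py r) (pxs , rx) ∷ allPairs-mapWith f pxs rxs

-- Branching on selectable vertices and candidate private neighbours

module Count {n} (G : Graph n) where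

  open Graph G using (adj; irrefl; Adjacent)

  adjacent-irrefl : ∀ {v} → ¬ Adjacent v v
  adjacent-irrefl {v} vv with () ← trans (sym vv) (irrefl v)

  adjacent-sym : ∀ {u v} → Adjacent u v → Adjacent v u
  adjacent-sym {u} {v} uv = trans (Graph.sym G v u) uv

  adjacent⇒≢ : ∀ {u v} → Adjacent u v → u ≢ v
  adjacent⇒≢ uv refl = adjacent-irrefl uv

  Good : Sub n → Sub n → Sub n → Set
  Good U C S = ∀ v → U ∋ v → S ∋ v → ∃[ x ]
    (C ∋ x × Adjacent x v × ¬ (U ∋ x × S ∋ x) ×
     (∀ w → U ∋ w → S ∋ w → Adjacent x w → w ≡ v))

  Differ : Sub n → Sub n → Sub n → Set
  Differ U S S′ = ∃[ i ] (U ∋ i × S i ≢ S′ i)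

  -- The sets are told apart on `U` only, so what is counted are their traces on `U`. The factor
  -- 10000 ^ n is the scale of the integer weights.
  Bounded : Sub n → Sub n → Set
  Bounded U C = ∀ Ss → AllPairs (Differ U) Ss → All (Good U C) Ss →
    length Ss * 10000 ^ n ≤ W U C

  IH : Sub n → Sub n → Set
  IH U C = ∀ {U′ C′} → W U′ C′ < W U C → Bounded U′ C′

  Agrees : List (Fin n × Bool) → Sub n → Set
  Agrees d S = All (λ (v , b) → S v ≡ b) d

  agrees? : ∀ d S → Dec (Agrees d S)
  agrees? d S = All.all? (λ (v , b) → S v Bool.≟ b) d

  infixl 6 _∖_ _∖∖_
  _∖_ : Sub n → List (Fin n) → Sub n
  C ∖ []       = C
  C ∖ (x ∷ xs) = (C ∖ xs) - x

  _∖∖_ : Sub n → List (Fin n × Bool) → Sub n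
  U ∖∖ d = U ∖ map proj₁ d

  ∖⁻ : ∀ C xs {x} → C ∖ xs ∋ x → C ∋ x × All (x ≢_) xs
  ∖⁻ C []       Cx = Cx , []
  ∖⁻ C (_ ∷ xs) Cx
    with Cx′ , x≢y ← -∋ {U = C ∖ xs} Cx with C∋x , x∉xs ← ∖⁻ C xs Cx′ = C∋x , x≢y ∷ x∉xs

  ∖-dec : ∀ C xs {x} → C ∋ x → C ∖ xs ∋ x ⊎ Any (x ≡_) xs
  ∖-dec C []       Cx = inj₁ Cx
  ∖-dec C (y ∷ xs) {x} Cx with x ≟ y
  ... | yes x≡y = inj₂ (here x≡y)
  ... | no _ with ∖-dec C xs Cx
  ...   | inj₁ p = inj₁ p
  ...   | inj₂ q = inj₂ (there q)

  ∖-∌ : ∀ U xs {x} → U x ≡ false → (U ∖ xs) x ≡ false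
  ∖-∌ U []       Ux = Ux
  ∖-∌ U (y ∷ xs) {x} Ux with x ≟ y
  ... | yes _ = refl
  ... | no _  = ∖-∌ U xs Ux

  -- Three reasons why x cannot be a private neighbour of a vertex still undecided. `dominated`
  -- covers even the private neighbours of v itself, because v, once decided, no longer has to show
  -- one.
  data Useless (U : Sub n) (d : List (Fin n × Bool)) (x : Fin n) : Set where
    chosen    : ∀ {v} → U ∋ v → Any ((v , true) ≡_) d → x ≡ v → Useless U d x
    dominated : ∀ {v} → U ∋ v → Any ((v , true) ≡_) d → Adjacent x v → Useless U d x
    isolated  : (∀ w → U ∖∖ d ∋ w → ¬ Adjacent x w) → Useless U d x

  agrees-true : ∀ {d S v} → Agrees d S → Any ((v , true) ≡_) d → S ∋ v
  agrees-true (Sv ∷ _)  (here refl) = Sv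
  agrees-true (_ ∷ ags) (there p)   = agrees-true ags p

  any-proj₁ : ∀ {d : List (Fin n × Bool)} {v b} → Any ((v , b) ≡_) d → Any (v ≡_) (map proj₁ d)
  any-proj₁ (here refl) = here refl
  any-proj₁ (there p)   = there (any-proj₁ p)

  all-≢ : ∀ {xs : List (Fin n)} {v} → All (v ≢_) xs → ¬ Any (v ≡_) xs
  all-≢ (v≢x ∷ _)   (here v≡x) = v≢x v≡x
  all-≢ (_ ∷ v≢xs)  (there p)  = all-≢ v≢xs p

  -- The branch keeps at most the fraction num/den of the weight; `smaller` makes the recursion on W
  -- well-founded.
  record Branch (U C : Sub n) : Set where
    constructor branching
    field
      decisions : List (Fin n × Bool)
      discarded : List (Fin n)
      num den   : ℕ
      useless   : All (Useless U decisions) discarded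
      ratio     : Ratio (W (U ∖∖ decisions) (C ∖ discarded)) (W U C) den num
      smaller   : T (num <ᵇ den)

  open Branch

  module _ {U C : Sub n} where

    good-branch : ∀ (b : Branch U C) {S} → Agrees (decisions b) S → Good U C S →
                  Good (U ∖∖ decisions b) (C ∖ discarded b) S
    good-branch b {S} ag good v U′v Sv
      with Uv , v∉d ← ∖⁻ U (map proj₁ (decisions b)) U′v
      with x , Cx , xv , x∉S , only ← good v Uv Sv = x , C′x , xv , x∉S′ , only′
      where
      d = decisions b

      only′ : ∀ w → U ∖∖ d ∋ w → S ∋ w → Adjacent x w → w ≡ v
      only′ w U′w = only w (proj₁ (∖⁻ U (map proj₁ d) U′w))

      x∉S′ : ¬ (U ∖∖ d ∋ x × S ∋ x)
      x∉S′ (U′x , Sx) = x∉S (proj₁ (∖⁻ U (map proj₁ d) U′x) , Sx)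

      ¬useless : ¬ Useless U d x
      ¬useless (chosen Ux t∈d refl)   = x∉S (Ux , agrees-true ag t∈d)
      -- The selected neighbour of x must be v, as x is private to v; but that neighbour is decided
      -- and v is not.
      ¬useless (dominated Uw t∈d xw)  =
        all-≢ v∉d (subst (λ w → Any (w ≡_) (map proj₁ d)) (only _ Uw (agrees-true ag t∈d) xw) (any-proj₁ t∈d))
      ¬useless (isolated no-nbr)      = no-nbr v U′v xv

      C′x : C ∖ discarded b ∋ x
      C′x with ∖-dec C (discarded b) Cx
      ... | inj₁ p = p
      ... | inj₂ q = contradiction (useful (useless b) q) ¬useless
        where
        useful : ∀ {xs} → All (Useless U d) xs → Any (x ≡_) xs → Useless U d x
        useful (u ∷ _)  (here refl) = u
        useful (_ ∷ us) (there p)   = useful us p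

    agrees-eq : ∀ {d S S′ i} → Agrees d S → Agrees d S′ → Any (i ≡_) (map proj₁ d) → S i ≡ S′ i
    agrees-eq {_ ∷ _} (p ∷ _)  (q ∷ _)  (here refl) = trans p (sym q)
    agrees-eq {_ ∷ _} (_ ∷ ps) (_ ∷ qs) (there m)   = agrees-eq ps qs m

    differ-branch : ∀ d {S S′} → Agrees d S → Agrees d S′ → Differ U S S′ → Differ (U ∖∖ d) S S′
    differ-branch d ag ag′ (i , Ui , S≢S′) with ∖-dec U (map proj₁ d) Ui
    ... | inj₁ U′i = i , U′i , S≢S′
    ... | inj₂ i∈d = contradiction (agrees-eq ag ag′ i∈d) S≢S′

    ratios : List (Branch U C) → List (ℕ × ℕ)
    ratios = map (λ b → den b , num b)

    smaller⇒W< : (b : Branch U C) → W (U ∖∖ decisions b) (C ∖ discarded b) < W U C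
    smaller⇒W< b = *-cancelʳ-< (den b) _ _ (≤-<-trans (clear (ratio b))
      (*-monoʳ-< (W U C) {{W-nonZero U C}} (<ᵇ⇒< _ _ (smaller b))))

    -- Each set is charged to the first branch with which it agrees, so the branches may overlap and
    -- need only cover.
    split : IH U C → (bs : List (Branch U C)) → ∀ Ss → AllPairs (Differ U) Ss → All (Good U C) Ss →
      All (λ S → Any (λ b → Agrees (decisions b) S) bs) Ss →
      Ratio (length Ss * 10000 ^ n) (W U C) (proj₁ (total (ratios bs))) (proj₂ (total (ratios bs)))
    split ih []       []      _     _     _        = cleared z≤n
    split ih []       (_ ∷ _) _     _     (() ∷ _)
    split ih (b ∷ bs) Ss      differ goods covered = cleared (begin
      length Ss * D * (den b * P)
        ≡⟨ cong (λ l → l * D * (den b * P)) (filter-split agrees Ss) ⟩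
      (length Ss₁ + length Ss₂) * D * (den b * P)
        ≡⟨ solve 5 (λ l m e x p → (l :+ m) :* e :* (x :* p) := l :* e :* x :* p :+ m :* e :* p :* x)
             refl (length Ss₁) (length Ss₂) D (den b) P ⟩
      length Ss₁ * D * den b * P + length Ss₂ * D * P * den b
        ≤⟨ +-mono-≤ (*-monoˡ-≤ P (*-monoˡ-≤ (den b) bound₁)) (*-monoˡ-≤ (den b) bound₂) ⟩
      W (U ∖∖ decisions b) (C ∖ discarded b) * den b * P + W U C * Q * den b
        ≤⟨ +-monoˡ-≤ _ (*-monoˡ-≤ P (clear (ratio b))) ⟩
      W U C * num b * P + W U C * Q * den b
        ≡⟨ solve 5 (λ w m p q x → w :* m :* p :+ w :* q :* x := w :* (m :* p :+ x :* q))
             refl (W U C) (num b) P Q (den b) ⟩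
      W U C * (num b * P + den b * Q)
        ∎)
      where
      open ≤-Reasoning
      D = 10000 ^ n
      P = proj₁ (total (ratios bs))
      Q = proj₂ (total (ratios bs))
      agrees = agrees? (decisions b)
      Ss₁ = filter agrees Ss
      Ss₂ = filter (¬? ∘ agrees) Ss

      bound₁ : length Ss₁ * D ≤ W (U ∖∖ decisions b) (C ∖ discarded b)
      bound₁ = ih (smaller⇒W< b) Ss₁
        (allPairs-mapWith (differ-branch (decisions b)) (All.all-filter agrees Ss)
          (AllPairs.filter⁺ agrees differ))
        (All.zipWith (λ (ag , good) → good-branch b ag good)
          (All.all-filter agrees Ss , All.filter⁺ agrees goods))

      later : ∀ {S} → Any (λ b → Agrees (decisions b) S) (b ∷ bs) × ¬ Agrees (decisions b) S →
              Any (λ b → Agrees (decisions b) S) bs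
      later (here ag , ¬ag) = contradiction ag ¬ag
      later (there p , _)   = p

      bound₂ : length Ss₂ * D * P ≤ W U C * Q
      bound₂ = clear (split ih bs Ss₂ (AllPairs.filter⁺ (¬? ∘ agrees) differ)
        (All.filter⁺ (¬? ∘ agrees) goods)
        (All.zipWith later (All.filter⁺ (¬? ∘ agrees) covered , All.all-filter (¬? ∘ agrees) Ss)))

    -- The two numerical hypotheses concern closed numbers in every application, so `tt` proves them
    -- once the ratios have fixed `num` and `den`.
    branch-bound : IH U C → (bs : List (Branch U C)) → T (0 <ᵇ proj₁ (total (ratios bs))) →
      AtMostOne (ratios bs) →
      (∀ S → Good U C S → Any (λ b → Agrees (decisions b) S) bs) → Bounded U C
    branch-bound ih bs P>0 ≤1 cover Ss differ goods =
      *-cancelʳ-≤ _ _ (proj₁ (total (ratios bs))) {{>-nonZero (<ᵇ⇒< 0 _ P>0)}}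
        (≤-trans (clear (split ih bs Ss differ goods (All.map (cover _) goods)))
          (*-monoʳ-≤ (W U C) (≤ᵇ⇒≤ _ _ ≤1)))

  module Step {U C : Sub n} (ih : IH U C) where

    del : ∀ (V : Sub n) {v i} → V ∋ i → i ≢ v → V - v ∋ i
    del V = ∋- {U = V}

    out in′ : Fin n → Fin n × Bool
    out v = v , false
    in′ v = v , true

    by-value : ∀ {S : Sub n} {v} {P : Set} → (S v ≡ false → P) → (S v ≡ true → P) → P
    by-value {S} {v} f t with S v in eq
    ... | false = f refl
    ... | true  = t refl

    ¬true : ∀ {b} → ¬ b ≡ true → b ≡ false
    ¬true = ¬-not

    no-private : ∀ {v} → U ∋ v → (∀ x → C ∋ x → ¬ Adjacent x v) → Bounded U C
    no-private {v} Uv none = branch-bound ih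
      (branching (out v ∷ []) [] _ _ [] (deleteU Uv) tt ∷ []) tt tt
      λ S good → here (¬true (λ Sv → let x , Cx , xv , _ = good v Uv Sv in none x Cx xv) ∷ [])

    -- The first tight case: 12886/19332 + (10000/19332)(15521/19332)² is just below 1. As x and y
    -- may lie in `U` too, their removal from `C` is charged at the weaker ratio of `deleteC`.
    both-two : ∀ {v x y} → U ∋ v → C ∋ v → C ∋ x → C ∋ y → Adjacent x v → Adjacent y v → y ≢ x →
               Bounded U C
    both-two {v} {x} {y} Uv Cv Cx Cy xv yv y≢x = branch-bound ih
      ( branching (out v ∷ []) [] _ _ [] (deleteU Uv) tt
      ∷ branching (in′ v ∷ []) (y ∷ x ∷ v ∷ []) _ _
          (dominated Uv (here refl) yv ∷ dominated Uv (here refl) xv ∷ chosen Uv (here refl) refl ∷ [])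
          (ratio-trans (deleteBoth Uv Cv) (ratio-trans
            (deleteC (del C Cx (adjacent⇒≢ xv)))
            (deleteC (del (C - v) (del C Cy (adjacent⇒≢ yv)) y≢x)))) tt
      ∷ []) tt tt
      λ S _ → by-value {S} {v} (λ ¬Sv → here (¬Sv ∷ [])) (λ Sv → there (here (Sv ∷ [])))

    Sole : Fin n → Fin n → Set
    Sole v x = ∀ y → C ∋ y → Adjacent y v → y ≡ x

    -- A selected v must have its only candidate x as private neighbour, so neither x nor any other
    -- neighbour of x in `U` is selected.
    forced : ∀ {v x S} → Sole v x → Good U C S → U ∋ v → S ∋ v →
      (U ∋ x → S x ≡ false) × (∀ w → U ∋ w → Adjacent x w → w ≢ v → S w ≡ false)
    forced {v} sole good Uv Sv
      with y , Cy , yv , y∉S , only ← good v Uv Sv with refl ← sole y Cy yv =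
      (λ Ux → ¬true λ Sx → y∉S (Ux , Sx)) ,
      (λ w Uw xw w≢v → ¬true λ Sw → w≢v (only w Uw Sw xw))

    -- A voter of a candidate x is a neighbour of x that may still be selected.
    another-voter : ∀ v x → Dec (∃[ w ] (U ∋ w × Adjacent x w × w ≢ v))
    another-voter v x = any? λ w → (U w Bool.≟ true) ×-dec (adj x w Bool.≟ true) ×-dec ¬? (w ≟ v)

    lonely : ∀ {v x d} → Any (v ≡_) (map proj₁ d) →
      ¬ (∃[ w ] (U ∋ w × Adjacent x w × w ≢ v)) → Useless U d x
    lonely {v} {x} {d} v∈d none = isolated λ w U′w xw →
      let Uw , w∉d = ∖⁻ U (map proj₁ d) U′w in
      none (w , Uw , xw , λ { refl → all-≢ w∉d v∈d })

    -- Selecting v forces x to be private. Either this excludes x itself or another voter of x from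
    -- the selection, or v is the last voter of x, and then x leaves `C` in both branches.
    both-sole : ∀ {v x} → U ∋ v → C ∋ v → C ∋ x → Adjacent x v → Sole v x → Bounded U C
    both-sole {v} {x} Uv Cv Cx xv sole with U x in Ux
    ... | true = branch-bound ih
      ( branching (out v ∷ []) [] _ _ [] (deleteU Uv) tt
      ∷ branching (out x ∷ in′ v ∷ []) (x ∷ v ∷ []) _ _
          (dominated Uv (there (here refl)) xv ∷ chosen Uv (there (here refl)) refl ∷ [])
          (ratio-trans (deleteBoth Uv Cv)
            (deleteBoth (del U Ux (adjacent⇒≢ xv)) (del C Cx (adjacent⇒≢ xv)))) tt
      ∷ []) tt tt
      λ S good → by-value {S} {v} (λ ¬Sv → here (¬Sv ∷ []))
        (λ Sv → there (here (proj₁ (forced sole good Uv Sv) Ux ∷ Sv ∷ [])))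
    ... | false with another-voter v x
    ... | yes (w , Uw , xw , w≢v) = branch-bound ih
      ( branching (out v ∷ []) [] _ _ [] (deleteU Uv) tt
      ∷ branching (out w ∷ in′ v ∷ []) (x ∷ v ∷ []) _ _
          (dominated Uv (there (here refl)) xv ∷ chosen Uv (there (here refl)) refl ∷ [])
          (ratio-trans (deleteBoth Uv Cv) (ratio-trans (deleteU (del U Uw w≢v))
            (deleteC-only (del C Cx (adjacent⇒≢ xv)) (∖-∌ U (w ∷ v ∷ []) Ux)))) tt
      ∷ []) tt tt
      λ S good → by-value {S} {v} (λ ¬Sv → here (¬Sv ∷ []))
        (λ Sv → there (here (proj₂ (forced sole good Uv Sv) w Uw xw w≢v ∷ Sv ∷ [])))
    ... | no none = branch-bound ih
      ( branching (out v ∷ []) (x ∷ []) _ _ (lonely (here refl) none ∷ [])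
          (ratio-trans (deleteU Uv) (deleteC-only Cx (∖-∌ U (v ∷ []) Ux))) tt
      ∷ branching (in′ v ∷ []) (x ∷ v ∷ []) _ _
          (dominated Uv (here refl) xv ∷ chosen Uv (here refl) refl ∷ [])
          (ratio-trans (deleteBoth Uv Cv)
            (deleteC-only (del C Cx (adjacent⇒≢ xv)) (∖-∌ U (v ∷ []) Ux))) tt
      ∷ []) tt tt
      λ S _ → by-value {S} {v} (λ ¬Sv → here (¬Sv ∷ [])) (λ Sv → there (here (Sv ∷ [])))

    another-private : ∀ v x → Dec (∃[ y ] (C ∋ y × Adjacent y v × y ≢ x))
    another-private v x = any? λ y → (C y Bool.≟ true) ×-dec (adj y v Bool.≟ true) ×-dec ¬? (y ≟ x)

    ≡-stable : ∀ {x y : Fin n} → ¬ x ≢ y → x ≡ y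
    ≡-stable {x} {y} = decidable-stable (x ≟ y)

    module Disjoint (disjoint : ∀ {v} → U ∋ v → C v ≡ false) where

      C⇒¬U : ∀ {x} → C ∋ x → U x ≡ false
      C⇒¬U Cx = ¬true λ Ux → true≢false (trans (sym Cx) (disjoint Ux))
        where
        true≢false : true ≢ false
        true≢false ()

      -- Without another voter, v and x form an isolated edge between `U` and `C` and leave together
      -- in both branches. This is the second tight case, 2 ≤ 1.5521 · 1.2886.
      sole-private : ∀ {v x} → U ∋ v → C ∋ x → Adjacent x v → Sole v x → Bounded U C
      sole-private {v} {x} Uv Cx xv sole with another-voter v x
      ... | yes (w , Uw , xw , w≢v) = branch-bound ih
        ( branching (out v ∷ []) [] _ _ [] (deleteU-only Uv (disjoint Uv)) tt
        ∷ branching (out w ∷ in′ v ∷ []) (x ∷ []) _ _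
            (dominated Uv (there (here refl)) xv ∷ [])
            (ratio-trans (deleteU-only Uv (disjoint Uv)) (ratio-trans
              (deleteU-only (del U Uw w≢v) (disjoint Uw))
              (deleteC-only Cx (∖-∌ U (w ∷ v ∷ []) (C⇒¬U Cx))))) tt
        ∷ []) tt tt
        λ S good → by-value {S} {v} (λ ¬Sv → here (¬Sv ∷ []))
          (λ Sv → there (here (proj₂ (forced sole good Uv Sv) w Uw xw w≢v ∷ Sv ∷ [])))
      ... | no none = branch-bound ih
        ( branching (out v ∷ []) (x ∷ []) _ _ (lonely (here refl) none ∷ [])
            (ratio-trans (deleteU-only Uv (disjoint Uv))
              (deleteC-only Cx (∖-∌ U (v ∷ []) (C⇒¬U Cx)))) tt
        ∷ branching (in′ v ∷ []) (x ∷ []) _ _ (dominated Uv (here refl) xv ∷ [])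
            (ratio-trans (deleteU-only Uv (disjoint Uv))
              (deleteC-only Cx (∖-∌ U (v ∷ []) (C⇒¬U Cx)))) tt
        ∷ []) tt tt
        λ S _ → by-value {S} {v} (λ ¬Sv → here (¬Sv ∷ [])) (λ Sv → there (here (Sv ∷ [])))

      -- Three candidates lost on selecting v pay for the branching, whoever their voters are.
      three-privates : ∀ {v x y z} → U ∋ v → C ∋ x → C ∋ y → C ∋ z →
        Adjacent x v → Adjacent y v → Adjacent z v → y ≢ x → z ≢ x → z ≢ y → Bounded U C
      three-privates {v} {x} {y} {z} Uv Cx Cy Cz xv yv zv y≢x z≢x z≢y = branch-bound ih
        ( branching (out v ∷ []) [] _ _ [] (deleteU-only Uv (disjoint Uv)) tt
        ∷ branching (in′ v ∷ []) (z ∷ y ∷ x ∷ []) _ _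
            (dominated Uv (here refl) zv ∷ dominated Uv (here refl) yv ∷
             dominated Uv (here refl) xv ∷ [])
            (ratio-trans (deleteU-only Uv (disjoint Uv)) (ratio-trans (deleteC Cx)
              (ratio-trans (deleteC (del C Cy y≢x))
                (deleteC (del (C - x) (del C Cz z≢x) z≢y))))) tt
        ∷ []) tt tt
        λ S _ → by-value {S} {v} (λ ¬Sv → here (¬Sv ∷ [])) (λ Sv → there (here (Sv ∷ [])))

      -- Deciding v removes x from `C` either way, as v is its only voter.
      sole-voter : ∀ {v x y} → U ∋ v → C ∋ x → C ∋ y → Adjacent x v → Adjacent y v → y ≢ x →
        ¬ (∃[ w ] (U ∋ w × Adjacent x w × w ≢ v)) → Bounded U C
      sole-voter {v} {x} {y} Uv Cx Cy xv yv y≢x none = branch-bound ih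
        ( branching (out v ∷ []) (x ∷ []) _ _ (lonely (here refl) none ∷ [])
            (ratio-trans (deleteU-only Uv (disjoint Uv))
              (deleteC-only Cx (∖-∌ U (v ∷ []) (C⇒¬U Cx)))) tt
        ∷ branching (in′ v ∷ []) (y ∷ x ∷ []) _ _
            (dominated Uv (here refl) yv ∷ dominated Uv (here refl) xv ∷ [])
            (ratio-trans (deleteU-only Uv (disjoint Uv)) (ratio-trans
              (deleteC-only Cx (∖-∌ U (v ∷ []) (C⇒¬U Cx)))
              (deleteC-only (del C Cy y≢x) (∖-∌ U (v ∷ []) (C⇒¬U Cy))))) tt
        ∷ []) tt tt
        λ S _ → by-value {S} {v} (λ ¬Sv → here (¬Sv ∷ [])) (λ Sv → there (here (Sv ∷ [])))

      -- If v and w are both left out, x has no voter; whichever of them is selected removes x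
      -- together with its second candidate. The vertices y and z may coincide, as they leave in
      -- different branches.
      two-voters : ∀ {v w x y z} → U ∋ v → U ∋ w → C ∋ x → C ∋ y → C ∋ z →
        Adjacent x v → Adjacent y v → Adjacent x w → Adjacent z w → w ≢ v → y ≢ x → z ≢ x →
        (∀ u → U ∋ u → Adjacent x u → u ≢ v → u ≢ w → ⊥) → Bounded U C
      two-voters {v} {w} {x} {y} {z} Uv Uw Cx Cy Cz xv yv xw zw w≢v y≢x z≢x none = branch-bound ih
        ( branching (out w ∷ out v ∷ []) (x ∷ []) _ _ (isolated dead ∷ [])
            (ratio-trans out-both (deleteC-only Cx (∖-∌ U (w ∷ v ∷ []) (C⇒¬U Cx)))) tt
        ∷ branching (in′ w ∷ out v ∷ []) (z ∷ x ∷ []) _ _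
            (dominated Uw (here refl) zw ∷ dominated Uw (here refl) xw ∷ [])
            (ratio-trans out-both (ratio-trans
              (deleteC-only Cx (∖-∌ U (w ∷ v ∷ []) (C⇒¬U Cx)))
              (deleteC-only (del C Cz z≢x) (∖-∌ U (w ∷ v ∷ []) (C⇒¬U Cz))))) tt
        ∷ branching (in′ v ∷ []) (y ∷ x ∷ []) _ _
            (dominated Uv (here refl) yv ∷ dominated Uv (here refl) xv ∷ [])
            (ratio-trans (deleteU-only Uv (disjoint Uv)) (ratio-trans
              (deleteC-only Cx (∖-∌ U (v ∷ []) (C⇒¬U Cx)))
              (deleteC-only (del C Cy y≢x) (∖-∌ U (v ∷ []) (C⇒¬U Cy))))) tt
        ∷ []) tt tt
        λ S _ → by-value {S} {v}
          (λ ¬Sv → by-value {S} {w} (λ ¬Sw → here (¬Sw ∷ ¬Sv ∷ []))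
            (λ Sw → there (here (Sw ∷ ¬Sv ∷ []))))
          (λ Sv → there (there (here (Sv ∷ []))))
        where
        out-both : Ratio (W ((U - v) - w) C) (W U C) _ _
        out-both = ratio-trans (deleteU-only Uv (disjoint Uv))
          (deleteU-only (del U Uw w≢v) (disjoint Uw))

        dead : ∀ u → (U - v) - w ∋ u → ¬ Adjacent x u
        dead u U′u xu with U″u , u≢w ← -∋ {U = U - v} U′u with Uu , u≢v ← -∋ {U = U} U″u =
          none u Uu xu u≢v u≢w

      ThreeVoters : Fin n → Fin n → Set
      ThreeVoters v x = ∃[ a ] ∃[ b ]
        ( U ∋ a × Adjacent x a × a ≢ v
        × U ∋ b × Adjacent x b × b ≢ v × b ≢ a)

      -- A selected v has x or y as private neighbour, and the one that is private excludes two
      -- further voters. The two branches overlap when both are private.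
      many-voters : ∀ {v x y} → U ∋ v → C ∋ x → C ∋ y → Adjacent x v → Adjacent y v → y ≢ x →
        (∀ z → C ∋ z → Adjacent z v → z ≡ x ⊎ z ≡ y) →
        ThreeVoters v x → ThreeVoters v y → Bounded U C
      many-voters {v} {x} {y} Uv Cx Cy xv yv y≢x xy
        (a , b , Ua , xa , a≢v , Ub , xb , b≢v , b≢a)
        (a′ , b′ , Ua′ , ya′ , a′≢v , Ub′ , yb′ , b′≢v , b′≢a′) = branch-bound ih
        ( branching (out v ∷ []) [] _ _ [] (deleteU-only Uv (disjoint Uv)) tt
        ∷ branching (decide a b) (y ∷ x ∷ []) _ _ private-useless
            (private-ratio Ua Ub a≢v b≢v b≢a) tt
        ∷ branching (decide a′ b′) (y ∷ x ∷ []) _ _ private-useless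
            (private-ratio Ua′ Ub′ a′≢v b′≢v b′≢a′) tt
        ∷ []) tt tt
        λ S good → by-value {S} {v} (λ ¬Sv → here (¬Sv ∷ [])) (λ Sv → there (Sum.[ here , there ∘ here ]′ (chosen-private good Sv)))
        where
        decide : Fin n → Fin n → List (Fin n × Bool)
        decide a b = out b ∷ out a ∷ in′ v ∷ []

        private-useless : ∀ {a b} → All (Useless U (decide a b)) (y ∷ x ∷ [])
        private-useless = dominated Uv (there (there (here refl))) yv ∷
          dominated Uv (there (there (here refl))) xv ∷ []

        private-ratio : ∀ {a b} → U ∋ a → U ∋ b → a ≢ v → b ≢ v → b ≢ a →
          Ratio (W (U ∖∖ decide a b) (C ∖ (y ∷ x ∷ []))) (W U C) _ _
        private-ratio {a} {b} Ua Ub a≢v b≢v b≢a =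
          ratio-trans (deleteU-only Uv (disjoint Uv)) (ratio-trans
          (deleteU-only (del U Ua a≢v) (disjoint Ua)) (ratio-trans
          (deleteU-only (del (U - v) (del U Ub b≢v) b≢a) (disjoint Ub)) (ratio-trans
          (deleteC-only Cx (∖-∌ U (b ∷ a ∷ v ∷ []) (C⇒¬U Cx)))
          (deleteC-only (del C Cy y≢x) (∖-∌ U (b ∷ a ∷ v ∷ []) (C⇒¬U Cy))))))

        chosen-private : ∀ {S} → Good U C S → S ∋ v → Agrees (decide a b) S ⊎ Agrees (decide a′ b′) S
        chosen-private good Sv with z , Cz , zv , z∉S , only ← good v Uv Sv with xy z Cz zv
        ... | inj₁ refl = inj₁
          (¬true (λ Sb → b≢v (only b Ub Sb xb)) ∷ ¬true (λ Sa → a≢v (only a Ua Sa xa)) ∷ Sv ∷ [])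
        ... | inj₂ refl = inj₂
          (¬true (λ Sb → b′≢v (only b′ Ub′ Sb yb′)) ∷ ¬true (λ Sa → a′≢v (only a′ Ua′ Sa ya′)) ∷ Sv ∷ [])

      -- If x has exactly one further voter w, either w has a second candidate, which gives
      -- `two-voters`, or the branching moves to w, whose sole candidate is x.
      few-voters : ∀ {v x y} → U ∋ v → C ∋ x → C ∋ y → Adjacent x v → Adjacent y v → y ≢ x →
        Bounded U C ⊎ ThreeVoters v x
      few-voters {v} {x} {y} Uv Cx Cy xv yv y≢x with another-voter v x
      ... | no none = inj₁ (sole-voter Uv Cx Cy xv yv y≢x none)
      ... | yes (w , Uw , xw , w≢v)
        with any? (λ u → (U u Bool.≟ true) ×-dec (adj x u Bool.≟ true) ×-dec ¬? (u ≟ v) ×-dec ¬? (u ≟ w))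
      ...   | yes (u , Uu , xu , u≢v , u≢w) = inj₂ (w , u , Uw , xw , w≢v , Uu , xu , u≢v , u≢w)
      ...   | no none with another-private w x
      ...     | yes (z , Cz , zw , z≢x) = inj₁ (two-voters Uv Uw Cx Cy Cz xv yv xw zw w≢v y≢x z≢x
                  λ u Uu xu u≢v u≢w → none (u , Uu , xu , u≢v , u≢w))
      ...     | no sole = inj₁ (sole-private Uw Cx xw
                  λ z Cz zw → ≡-stable λ z≢x → sole (z , Cz , zw , z≢x))

      disjoint-bound : ∀ {v x} → U ∋ v → C ∋ x → Adjacent x v → Bounded U C
      disjoint-bound {v} {x} Uv Cx xv with another-private v x
      ... | no sole = sole-private Uv Cx xv λ z Cz zv → ≡-stable λ z≢x → sole (z , Cz , zv , z≢x)
      ... | yes (y , Cy , yv , y≢x)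
        with any? (λ z → (C z Bool.≟ true) ×-dec (adj z v Bool.≟ true) ×-dec ¬? (z ≟ x) ×-dec ¬? (z ≟ y))
      ...   | yes (z , Cz , zv , z≢x , z≢y) = three-privates Uv Cx Cy Cz xv yv zv y≢x z≢x z≢y
      ...   | no two with few-voters Uv Cx Cy xv yv y≢x | few-voters Uv Cy Cx yv xv (y≢x ∘ sym)
      ...     | inj₁ bound | _          = bound
      ...     | inj₂ _     | inj₁ bound = bound
      ...     | inj₂ vx    | inj₂ vy    = many-voters Uv Cx Cy xv yv y≢x x-or-y vx vy
        where
        x-or-y : ∀ z → C ∋ z → Adjacent z v → z ≡ x ⊎ z ≡ y
        x-or-y z Cz zv with z ≟ x
        ... | yes z≡x = inj₁ z≡x
        ... | no z≢x  = inj₂ (≡-stable λ z≢y → two (z , Cz , zv , z≢x , z≢y))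

    empty : (∀ v → ¬ U ∋ v) → Bounded U C
    empty none []              _                _ = z≤n
    empty none (_ ∷ [])        _                _ = ≤-trans (≤-reflexive (+-identityʳ _)) (10000ⁿ≤W U C)
    empty none (_ ∷ _ ∷ _) (((i , Ui , _) ∷ _) ∷ _) _ = contradiction Ui (none i)

    private? : ∀ v → Dec (∃[ x ] (C ∋ x × Adjacent x v))
    private? v = any? λ x → (C x Bool.≟ true) ×-dec (adj x v Bool.≟ true)

    -- Vertices of `U` without a candidate are treated first, so that a candidate exists in all
    -- later cases; then those in `U` and `C`, after which the two sets are disjoint and removals
    -- have the exact ratios.
    bounded : Bounded U C
    bounded with any? (λ v → (U v Bool.≟ true) ×-dec ¬? (private? v))
    ... | yes (v , Uv , none) = no-private Uv λ x Cx xv → none (x , Cx , xv)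
    ... | no served with any? (λ v → (U v Bool.≟ true) ×-dec (C v Bool.≟ true))
    bounded | no served | yes (v , Uv , Cv)
      with x , Cx , xv ← decidable-stable (private? v) (λ none → served (v , Uv , none))
      with another-private v x
    ... | yes (y , Cy , yv , y≢x) = both-two Uv Cv Cx Cy xv yv y≢x
    ... | no sole = both-sole Uv Cv Cx xv λ y Cy yv → ≡-stable λ y≢x → sole (y , Cy , yv , y≢x)
    bounded | no served | no apart with any? (λ v → U v Bool.≟ true)
    ... | no none = empty λ v Uv → none (v , Uv)
    ... | yes (v , Uv)
      with x , Cx , xv ← decidable-stable (private? v) (λ none → served (v , Uv , none)) =
      Disjoint.disjoint-bound (λ {u} Uu → ¬true λ Cu → apart (u , Uu , Cu)) Uv Cx xv

  bounded-acc : ∀ {U C} → Acc _<_ (W U C) → Bounded U C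
  bounded-acc (accessible rs) = Step.bounded λ lt → bounded-acc (rs lt)

  HasPrivates : Sub n → Set
  HasPrivates S = ∀ v → S ∋ v → ∃[ x ]
    (Adjacent x v × S x ≡ false × (∀ w → S ∋ w → Adjacent x w → w ≡ v))

  count : ∀ Ss → AllPairs (λ S S′ → ∃[ i ] S i ≢ S′ i) Ss → All HasPrivates Ss →
    length Ss * 10000 ^ n ≤ 19332 ^ n
  count Ss differ privates = ≤-trans
    (bounded-acc (<-wellFounded _) Ss
      (AllPairs.map (λ (i , S≢S′) → i , refl , S≢S′) differ)
      (All.map good privates))
    (≤-reflexive (W-full n))
    where
    good : ∀ {S} → HasPrivates S → Good (λ _ → true) (λ _ → true) S
    good p v _ Sv with x , xv , Sx , only ← p v Sv =
      x , refl , xv , (λ (_ , Sx′) → contradiction (trans (sym Sx′) Sx) λ ()) , λ w _ → only w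

-- Cost semantics

⇓-deterministic : ∀ {k} {γ : Config k} {r r′} → γ ⇓ r → γ ⇓ r′ → r ≡ r′
⇓-deterministic halt       halt        = refl
⇓-deterministic (assign p) (assign p′) rewrite ⇓-deterministic p p′ = refl
⇓-deterministic (seq p)    (seq p′)    rewrite ⇓-deterministic p p′ = refl
⇓-deterministic (cond p)   (cond p′)   rewrite ⇓-deterministic p p′ = refl
⇓-deterministic (loop p)   (loop p′)   rewrite ⇓-deterministic p p′ = refl
⇓-deterministic (emit p)   (emit p′)   rewrite ⇓-deterministic p p′ = refl

record Fits {k} (M : ℕ) (σ : Store k) : Set where
  constructor fitting
  field size-at : ∀ x → size (lookup σ x) ≤ M

open Fits

space-fits : ∀ {k M} (σ : Store k) → Fits M σ → space σ ≤ k * M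
space-fits Vec.[]      fits = z≤n
space-fits (t Vec.∷ σ) (fitting fits) = +-mono-≤ (fits zero) (space-fits σ (fitting (fits ∘ suc)))

Closed : ∀ {k} → Expr k → Set
Closed (var x)    = ⊥
Closed nil        = ⊤
Closed (cons d e) = Closed d × Closed e
Closed (hd e)     = ⊥
Closed (tl e)     = ⊥

-- A tame expression enlarges the largest tree in the store by at most its
-- evaluation time, whereas cons x x may double it.
Tame : ∀ {k} → Expr k → Set
Tame (var x)    = ⊤
Tame nil        = ⊤
Tame (cons d e) = Closed d × Tame e
Tame (hd e)     = Tame e
Tame (tl e)     = Tame e

Straight : ∀ {k} → Cmd k → Set
Straight (x ≔ e)              = Tame e
Straight (c ⨾ d)              = Straight c × Straight d
Straight (if e then c else d) = Straight c × Straight d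
Straight (while e loop c)     = ⊥
Straight (output e)           = ⊥

-- The last two clauses, here and in `cost`, are placeholders: `Straight` excludes loops and
-- outputs.
exec : ∀ {k} → Cmd k → Store k → Store k
exec (x ≔ e)              σ = σ [ x ]≔ eval e σ
exec (c ⨾ d)              σ = exec d (exec c σ)
exec (if e then c else d) σ = branch (eval e σ) (exec c σ) (exec d σ)
exec (while e loop c)     σ = σ
exec (output e)           σ = σ

cost : ∀ {k} → Cmd k → ℕ
cost (x ≔ e)              = suc (evalTime e)
cost (c ⨾ d)              = suc (cost c + cost d)
cost (if e then c else d) = suc (evalTime e) + (cost c ⊔ cost d)
cost (while e loop c)     = 0
cost (output e)           = 0

size-head : ∀ t → size (head t) ≤ size t
size-head nil        = ≤-refl
size-head (cons s t) = m≤n⇒m≤1+n (m≤m+n (size s) (size t))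

size-tail : ∀ t → size (tail t) ≤ size t
size-tail nil        = ≤-refl
size-tail (cons s t) = m≤n⇒m≤1+n (m≤n+m (size t) (size s))

closed-size : ∀ {k} (e : Expr k) {σ} → Closed e → size (eval e σ) ≤ evalTime e
closed-size nil        _       = ≤-refl
closed-size (cons d e) (c , c′) = s≤s (+-mono-≤ (closed-size d c) (closed-size e c′))

tame-size : ∀ {k} (e : Expr k) {σ M} → Tame e → Fits M σ → size (eval e σ) ≤ M + evalTime e
tame-size (var x)    {M = M} _        fits = ≤-trans (size-at fits x) (m≤m+n M 1)
tame-size nil        {M = M} _        fits = m≤n+m 1 M
tame-size (cons d e) {σ} {M} (c , te) fits = begin
  suc (size (eval d σ) + size (eval e σ))  ≤⟨ s≤s (+-mono-≤ (closed-size d c) (tame-size e te fits)) ⟩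
  suc (evalTime d + (M + evalTime e))      ≡⟨ solve 3 (λ a m b → con 1 :+ (a :+ (m :+ b)) := m :+ (con 1 :+ (a :+ b)))
                                                refl (evalTime d) M (evalTime e) ⟩
  M + suc (evalTime d + evalTime e)        ∎
  where open ≤-Reasoning
tame-size (hd e) {σ} {M} te fits = ≤-trans (size-head (eval e σ))
  (≤-trans (tame-size e te fits) (+-monoʳ-≤ M (n≤1+n (evalTime e))))
tame-size (tl e) {σ} {M} te fits = ≤-trans (size-tail (eval e σ))
  (≤-trans (tame-size e te fits) (+-monoʳ-≤ M (n≤1+n (evalTime e))))

fits-mono : ∀ {k M M′} {σ : Store k} → M ≤ M′ → Fits M σ → Fits M′ σ
fits-mono M≤M′ fits = fitting λ x → ≤-trans (size-at fits x) M≤M′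

fits-update : ∀ {k M t} {σ : Store k} x → Fits M σ → size t ≤ M → Fits M (σ [ x ]≔ t)
fits-update {M = M} {t} {σ} x (fitting fits) t≤M = fitting updated
  where
  updated : ∀ y → size (lookup (σ [ x ]≔ t) y) ≤ M
  updated y with y ≟ x
  ... | yes refl = subst (λ s → size s ≤ M) (sym (Vec.lookup∘update x σ t)) t≤M
  ... | no y≢x   = subst (λ s → size s ≤ M) (sym (Vec.lookup∘update′ y≢x σ t)) (fits y)

infix 4 _⟶[_]_

-- The number t bounds both the time and the growth of the largest tree, since a tame assignment
-- adds at most its cost. `runs` goes backwards because `_⇓_` builds the run of a configuration from
-- that of its successor.
record _⟶[_]_ {k} (γ : Config k) (t : ℕ) (γ′ : Config k) : Set where
  field
    fits : ∀ {M} → Fits M (proj₂ γ) → Fits (M + t) (proj₂ γ′)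
    runs : ∀ {M r} → Fits M (proj₂ γ) → γ′ ⇓ r → ∃[ r′ ]
      ( γ ⇓ r′ × firstGap r′ ≤ t + firstGap r × emitted r′ ≡ emitted r
      × peak r′ ≤ k * (M + t) ⊔ peak r)

open _⟶[_]_

weaken : ∀ {k t t′} {γ γ′ : Config k} → t ≤ t′ → γ ⟶[ t ] γ′ → γ ⟶[ t′ ] γ′
weaken {k} t≤t′ s .fits {M} f = fits-mono (+-monoʳ-≤ M t≤t′) (s .fits f)
weaken {k} t≤t′ s .runs {M} {r} f p with r′ , p′ , g , e , s≤ ← s .runs f p =
  r′ , p′ , ≤-trans g (+-monoˡ-≤ (firstGap r) t≤t′) , e ,
  ≤-trans s≤ (⊔-monoˡ-≤ (peak r) (*-monoʳ-≤ k (+-monoʳ-≤ M t≤t′)))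

infixr 5 _▹_

_▹_ : ∀ {k t₁ t₂} {γ₁ γ₂ γ₃ : Config k} → γ₁ ⟶[ t₁ ] γ₂ → γ₂ ⟶[ t₂ ] γ₃ → γ₁ ⟶[ t₁ + t₂ ] γ₃
_▹_ {k} {t₁} {t₂} {γ₃ = _ , σ₃} s₁ s₂ .fits {M} f =
  subst (λ m → Fits m σ₃) (+-assoc M t₁ t₂) (s₂ .fits (s₁ .fits f))
_▹_ {k} {t₁} {t₂} s₁ s₂ .runs {M} {r} f p
  with r₂ , p₂ , g₂ , e₂ , b₂ ← s₂ .runs (s₁ .fits f) p
  with r₁ , p₁ , g₁ , e₁ , b₁ ← s₁ .runs f p₂ =
  r₁ , p₁ ,
  ≤-trans g₁ (≤-trans (+-monoʳ-≤ t₁ g₂) (≤-reflexive (sym (+-assoc t₁ t₂ (firstGap r))))) ,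
  trans e₁ e₂ ,
  ≤-trans b₁ (⊔-lub
    (≤-trans (*-monoʳ-≤ k (+-monoʳ-≤ M (m≤m+n t₁ t₂))) (m≤m⊔n _ _))
    (≤-trans b₂ (⊔-monoˡ-≤ (peak r) (≤-reflexive (cong (k *_) (+-assoc M t₁ t₂))))))

stay : ∀ {k} {γ : Config k} → γ ⟶[ 0 ] γ
stay .fits {M} f = fits-mono (m≤m+n M 0) f
stay {k} {γ} .runs {r = r} f p = r , p , ≤-refl , refl , m≤n⊔m _ (peak r)

silent : ∀ {k t} {K K′ : List (Cmd k)} {σ : Store k} →
  (∀ {r} → (K′ , σ) ⇓ r → (K , σ) ⇓ silently t (space σ) r) → (K , σ) ⟶[ t ] (K′ , σ)
silent {t = t} step .fits {M} f = fits-mono (m≤m+n M t) f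
silent {k} {t} {σ = σ} step .runs {M} {r} f p = _ , step p , ≤-refl , refl ,
  ⊔-monoˡ-≤ (peak r) (≤-trans (space-fits σ f) (*-monoʳ-≤ k (m≤m+n M t)))

sequence : ∀ {k} {c d : Cmd k} {K σ} → ((c ⨾ d) ∷ K , σ) ⟶[ 1 ] (c ∷ d ∷ K , σ)
sequence = silent seq

choose : ∀ {k} {e} {c d : Cmd k} {K σ} →
  ((if e then c else d) ∷ K , σ) ⟶[ suc (evalTime e) ] (branch (eval e σ) c d ∷ K , σ)
choose = silent cond

unroll : ∀ {k} {e} {c : Cmd k} {K σ} →
  ((while e loop c) ∷ K , σ) ⟶[ suc (evalTime e) ]
  (branch (eval e σ) (c ∷ (while e loop c) ∷ K) K , σ)
unroll = silent loop

assignment : ∀ {k} {x : Fin k} {e K σ} → Tame e →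
  (x ≔ e ∷ K , σ) ⟶[ suc (evalTime e) ] (K , σ [ x ]≔ eval e σ)
assignment {x = x} {e} tame .fits {M} f =
  fits-update x (fits-mono (m≤m+n M _) f)
    (≤-trans (tame-size e tame f) (+-monoʳ-≤ M (n≤1+n (evalTime e))))
assignment {k} {e = e} {σ = σ} tame .runs {M} {r} f p = _ , assign p , ≤-refl , refl ,
  ⊔-monoˡ-≤ (peak r) (≤-trans (space-fits σ f) (*-monoʳ-≤ k (m≤m+n M (suc (evalTime e)))))

straight : ∀ {k} (c : Cmd k) {K σ} → Straight c → (c ∷ K , σ) ⟶[ cost c ] (K , exec c σ)
straight (x ≔ e) tame         = assignment tame
straight (c ⨾ d) (sc , sd)    = sequence ▹ straight c sc ▹ straight d sd
straight (if e then c else d) {σ = σ} (sc , sd) = choose ▹ chosen (eval e σ)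
  where
  chosen : ∀ t {K} → (branch t c d ∷ K , σ) ⟶[ cost c ⊔ cost d ] (K , branch t (exec c σ) (exec d σ))
  chosen nil        = weaken (m≤n⊔m (cost c) (cost d)) (straight d sd)
  chosen (cons _ _) = weaken (m≤m⊔n (cost c) (cost d)) (straight c sc)

line : ∀ {k} (c : Cmd k) {s : Straight c} {K σ σ′} → exec c σ ≡ σ′ → (c ∷ K , σ) ⟶[ cost c ] (K , σ′)
line c {s} refl = straight c s

-- Silent steps put in front lengthen only the wait for the next output, so `first` is kept apart
-- from the bound `gap` on all later waits.
record Trace {k} (γ : Config k) (out : List Tree) (first gap mem : ℕ) : Set where
  field
    {result} : Run
    executes : γ ⇓ result
    prints   : outputs result ≡ out
    first≤   : firstGap result ≤ first
    gaps≤    : All (λ (_ , d) → d ≤ gap) (emitted result)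
    peak≤    : peak result ≤ k * mem

open Trace public

trace-halt : ∀ {k gap mem} {σ : Store k} → Fits mem σ → Trace ([] , σ) [] 0 gap mem
trace-halt f = record
  { executes = halt ; prints = refl ; first≤ = z≤n ; gaps≤ = [] ; peak≤ = space-fits _ f }

trace-weaken : ∀ {k out first first′ gap mem} {γ : Config k} → first ≤ first′ →
  Trace γ out first gap mem → Trace γ out first′ gap mem
trace-weaken le τ = record
  { executes = executes τ ; prints = prints τ ; first≤ = ≤-trans (first≤ τ) le
  ; gaps≤ = gaps≤ τ ; peak≤ = peak≤ τ }

-- The bound M refers to the store where these steps begin. Supplying it anew for each group of
-- steps keeps the growth from accumulating over the whole run.
trace-step : ∀ {k t M out first gap mem} {γ γ′ : Config k} → γ ⟶[ t ] γ′ →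
  Fits M (proj₂ γ) → M + t ≤ mem → Trace γ′ out first gap mem → Trace γ out (t + first) gap mem
trace-step {k} {t} {gap = gap} s f M+t≤mem τ with r , p , g , e , b ← s .runs f (executes τ) = record
  { executes = p
  ; prints   = trans (cong (map proj₁) e) (prints τ)
  ; first≤   = ≤-trans g (+-monoʳ-≤ t (first≤ τ))
  ; gaps≤    = subst (All _) (sym e) (gaps≤ τ)
  ; peak≤    = ≤-trans b (⊔-lub (*-monoʳ-≤ k M+t≤mem) (peak≤ τ))
  }

trace-emit : ∀ {k e K out first gap mem} {σ : Store k} → Fits mem σ → first ≤ gap →
  Trace (K , σ) out first gap mem →
  Trace (output e ∷ K , σ) (eval e σ ∷ out) (evalTime e + size (eval e σ)) gap mem
trace-emit f first≤gap τ = record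
  { executes = emit (executes τ)
  ; prints   = cong (_ ∷_) (prints τ)
  ; first≤   = ≤-refl
  ; gaps≤    = ≤-trans (first≤ τ) first≤gap ∷ gaps≤ τ
  ; peak≤    = ⊔-lub (space-fits _ f) (peak≤ τ)
  }

-- The enumeration program

-- Named fields let invariants be stated as record updates; `exec` then computes on the resulting
-- store, and most state equations hold by `refl`.
record Vars : Set where
  field
    graph set labels privates codes rows bits row col count zeros rest more ok : Tree

open Vars

⟪_⟫ : Vars → Store 14
⟪ v ⟫ = graph v Vec.∷ set v Vec.∷ labels v Vec.∷ privates v Vec.∷ codes v Vec.∷ rows v Vec.∷
        bits v Vec.∷ row v Vec.∷ col v Vec.∷ count v Vec.∷ zeros v Vec.∷ rest v Vec.∷
        more v Vec.∷ ok v Vec.∷ Vec.[]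

#graph #set #labels #privates #codes #rows #bits #row #col #count #zeros #rest #more #ok : Fin 14
#graph    = # 0
#set      = # 1
#labels   = # 2
#privates = # 3
#codes    = # 4
#rows     = # 5
#bits     = # 6
#row      = # 7
#col      = # 8
#count    = # 9
#zeros    = # 10
#rest     = # 11
#more     = # 12
#ok       = # 13

unary1 unary2 unary3 : Expr 14
unary1 = cons nil nil
unary2 = cons nil unary1
unary3 = cons nil unary2

skip advance : Cmd 14
skip = #graph ≔ var #graph

dotBody dotLoop : Cmd 14
dotBody =
  (if hd (var #row)
   then (if hd (var #col) then (#count ≔ cons nil (var #count)) else skip)
   else skip) ⨾
  #row ≔ tl (var #row) ⨾
  #col ≔ tl (var #col)
dotLoop = while var #row loop dotBody

-- One code is consed per row, so `codes` comes out in reverse order; `decode` reverses it again.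
loadRow codeRow collect : Cmd 14
loadRow = #row ≔ hd (var #rows) ⨾ #col ≔ var #set
codeRow =
  (if hd (var #bits) then (#codes ≔ cons unary2 (var #codes))
   else (if var #count
         then (if tl (var #count)
               then (#codes ≔ cons nil (var #codes))
               else (#codes ≔ cons unary3 (var #codes)))
         else (#codes ≔ cons unary1 (var #codes)))) ⨾
  #count ≔ nil ⨾
  #rows ≔ tl (var #rows) ⨾
  #bits ≔ tl (var #bits)
collect = while var #rows loop (loadRow ⨾ dotLoop ⨾ codeRow)

decodeBody decode : Cmd 14
decodeBody =
  (if hd (var #codes)
   then (if tl (hd (var #codes))
         then (if tl (tl (hd (var #codes)))
               then (#labels ≔ cons nil (var #labels) ⨾ #privates ≔ cons unary1 (var #privates))
               else (#labels ≔ cons unary2 (var #labels) ⨾ #privates ≔ cons nil (var #privates)))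
         else (#labels ≔ cons unary1 (var #labels) ⨾ #privates ≔ cons nil (var #privates)))
   else (#labels ≔ cons nil (var #labels) ⨾ #privates ≔ cons nil (var #privates))) ⨾
  #codes ≔ tl (var #codes)
decode = while var #codes loop decodeBody

-- A vertex marked in `privates` has exactly one selected neighbour, hence is private to any
-- selected vertex whose row meets it. A nonzero product with that row is therefore the test.
loadPrivates testRow verify : Cmd 14
loadPrivates = #row ≔ hd (var #rows) ⨾ #col ≔ var #privates
testRow =
  (if hd (var #bits) then (if var #count then skip else (#ok ≔ nil)) else skip) ⨾
  #count ≔ nil ⨾
  #rows ≔ tl (var #rows) ⨾
  #bits ≔ tl (var #bits)
verify = while var #rows loop (loadPrivates ⨾ dotLoop ⨾ testRow)

rewind rewindOk dropPrivates check : Cmd 14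
rewind       = #rows ≔ var #graph ⨾ #bits ≔ var #set
rewindOk     = rewind ⨾ #ok ≔ unary1
dropPrivates = #privates ≔ nil
check        = rewind ⨾ collect ⨾ decode ⨾ rewindOk ⨾ verify ⨾ dropPrivates

padBody pad-loop : Cmd 14
padBody  = #set ≔ cons nil (var #set) ⨾ #col ≔ tl (var #col)
pad-loop = while var #col loop padBody

advance = #rest ≔ tl (var #rest) ⨾ #zeros ≔ cons nil (var #zeros)

-- A binary counter, least significant bit first: rest is what remains of the
-- last set after as many bits, now reset, as zeros has.
candidate accept reject settle tryNext search : Cmd 14
candidate = #set ≔ cons unary1 (tl (var #rest)) ⨾ #col ≔ var #zeros
accept    = #more ≔ unary1 ⨾ #rest ≔ nil ⨾ #zeros ≔ nil ⨾ #ok ≔ nil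
reject    = #set ≔ nil ⨾ #labels ≔ nil ⨾ advance
settle    = if var #ok then accept else reject
tryNext   = candidate ⨾ pad-loop ⨾ check ⨾ settle
search    = while var #rest loop (if hd (var #rest) then advance else tryNext)

-- `more` stays nil unless the search accepts a candidate, so a failed search ends the enumeration.
startSearch report enumerate : Cmd 14
startSearch = #rest ≔ var #set ⨾ #set ≔ nil ⨾ #labels ≔ nil ⨾ #more ≔ nil
report      = output (var #labels) ⨾ startSearch ⨾ search
enumerate   = while var #more loop report

loadSize begin-enumeration program : Cmd 14
loadSize          = #col ≔ var #graph
begin-enumeration = #ok ≔ nil ⨾ #more ≔ unary1
program = loadSize ⨾ pad-loop ⨾ check ⨾ begin-enumeration ⨾ enumerate

vec : ∀ {n} → (Fin n → Tree) → Tree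
vec f = encodeList (tabulate f)

bitvec : ∀ {n} → (Fin n → Bool) → Tree
bitvec a = vec (encodeBool ∘ a)

tick : Bool → ℕ → ℕ
tick false acc = acc
tick true  acc = suc acc

dot : ∀ {n} → ℕ → (Fin n → Bool) → (Fin n → Bool) → ℕ
dot {zero}  acc a b = acc
dot {suc n} acc a b = dot (tick (a zero ∧ b zero) acc) (a ∘ suc) (b ∘ suc)

-- Each 2 is one evaluation of the loop guard; the last one is the exit.
dotTime : ℕ → ℕ
dotTime n = n * (2 + cost dotBody) + 2

dotBody-exec : ∀ v a b r c acc →
  exec dotBody ⟪ record v { row = cons (encodeBool a) r ; col = cons (encodeBool b) c ; count = encodeℕ acc } ⟫
  ≡ ⟪ record v { row = r ; col = c ; count = encodeℕ (tick (a ∧ b) acc) } ⟫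
dotBody-exec v false b     r c acc = refl
dotBody-exec v true  false r c acc = refl
dotBody-exec v true  true  r c acc = refl

dot-runs : ∀ {K} v {n} (a b : Fin n → Bool) acc →
  (dotLoop ∷ K , ⟪ record v { row = bitvec a ; col = bitvec b ; count = encodeℕ acc } ⟫)
  ⟶[ dotTime n ]
  (K , ⟪ record v { row = nil ; col = nil ; count = encodeℕ (dot acc a b) } ⟫)
dot-runs v {zero}  a b acc = unroll
dot-runs v {suc n} a b acc =
  unroll ▹ line dotBody (dotBody-exec v (a zero) (b zero) _ _ acc) ▹ dot-runs v (a ∘ suc) (b ∘ suc) _

rowTime : ℕ → Cmd 14 → Cmd 14 → ℕ
rowTime n load finish = 2 + (1 + (cost load + (1 + (dotTime n + cost finish))))

rowsTime : ℕ → ℕ → Cmd 14 → Cmd 14 → ℕ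
rowsTime m n load finish = m * rowTime n load finish + 2

iterate : ∀ {k} {γ γ′ γ″ : Config k} m {t e} →
  γ ⟶[ t ] γ′ → γ′ ⟶[ m * t + e ] γ″ → γ ⟶[ suc m * t + e ] γ″
iterate m {t} {e} s ss = weaken (≤-reflexive (sym (+-assoc t (m * t) e))) (s ▹ ss)

-- Codes 0, 1 and 2 are labels; 3 stands for the label 0 of a vertex with exactly
-- one selected neighbour.
code : Bool → ℕ → ℕ
code true  _             = 2
code false 0             = 1
code false 1             = 3
code false (suc (suc _)) = 0

codes-of : ∀ {m n} → (Fin m → Fin n → Bool) → (Fin m → Bool) → (Fin n → Bool) → Fin m → ℕ
codes-of a b s i = code (b i) (dot 0 (a i) s)

revOnto : ∀ {n} → (Fin n → Tree) → Tree → Tree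
revOnto {zero}  f t = t
revOnto {suc n} f t = revOnto (f ∘ suc) (cons (f zero) t)

onto : ∀ {n} → (Fin n → Tree) → Tree → Tree
onto {zero}  f t = t
onto {suc n} f t = cons (f zero) (onto (f ∘ suc) t)

onto-nil : ∀ {n} (f : Fin n → Tree) → onto f nil ≡ vec f
onto-nil {zero}  f = refl
onto-nil {suc n} f = cong (cons (f zero)) (onto-nil (f ∘ suc))

codeRow-exec : ∀ v b k {rs bs cs} →
  exec codeRow ⟪ record v { rows = rs ; bits = cons (encodeBool b) bs ; codes = cs
                          ; count = encodeℕ k } ⟫
  ≡ ⟪ record v { rows = tail rs ; bits = bs ; codes = cons (encodeℕ (code b k)) cs ; count = nil } ⟫
codeRow-exec v true  k             = refl
codeRow-exec v false 0             = refl
codeRow-exec v false 1             = refl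
codeRow-exec v false (suc (suc k)) = refl

collect-runs : ∀ {K} v {m n} (a : Fin m → Fin n → Bool) b (s : Fin n → Bool) cs →
  (collect ∷ K , ⟪ record v { set = bitvec s ; rows = vec (λ i → bitvec (a i)) ; bits = bitvec b
                            ; codes = cs ; row = nil ; col = nil ; count = nil } ⟫)
  ⟶[ rowsTime m n loadRow codeRow ]
  (K , ⟪ record v { set = bitvec s ; rows = nil ; bits = nil
                  ; codes = revOnto (encodeℕ ∘ codes-of a b s) cs
                  ; row = nil ; col = nil ; count = nil } ⟫)
collect-runs v {zero}  a b s cs = unroll
collect-runs v {suc m} a b s cs = iterate m
  (unroll ▹ sequence ▹ line loadRow refl ▹ sequence ▹
   dot-runs (record v { set = bitvec s ; rows = vec (λ i → bitvec (a i)) ; bits = bitvec b ; codes = cs }) (a zero) s 0 ▹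
   line codeRow (codeRow-exec
     (record v { set = bitvec s ; row = nil ; col = nil }) (b zero) (dot 0 (a zero) s)))
  (collect-runs v (a ∘ suc) (b ∘ suc) s _)

labelOf : ℕ → Fin 3
labelOf 0                   = 0F
labelOf 1                   = 1F
labelOf 2                   = 2F
labelOf (suc (suc (suc _))) = 0F

privateOf : ℕ → Bool
privateOf 0                   = false
privateOf 1                   = false
privateOf 2                   = false
privateOf (suc (suc (suc _))) = true

decodeBody-exec : ∀ v k {cs ls ps} →
  exec decodeBody ⟪ record v { codes = cons (encodeℕ k) cs ; labels = ls ; privates = ps } ⟫
  ≡ ⟪ record v { codes = cs ; labels = cons (encodeℕ (toℕ (labelOf k))) ls
               ; privates = cons (encodeBool (privateOf k)) ps } ⟫
decodeBody-exec v 0                   = refl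
decodeBody-exec v 1                   = refl
decodeBody-exec v 2                   = refl
decodeBody-exec v (suc (suc (suc k))) = refl

decodeTime : ℕ → ℕ
decodeTime n = n * (2 + cost decodeBody)

decode-loops : ∀ {K} v {n} (κ : Fin n → ℕ) cs ls ps →
  (decode ∷ K , ⟪ record v { codes = revOnto (encodeℕ ∘ κ) cs ; labels = ls ; privates = ps } ⟫)
  ⟶[ decodeTime n ]
  (decode ∷ K , ⟪ record v { codes = cs ; labels = onto (encodeℕ ∘ toℕ ∘ labelOf ∘ κ) ls
                           ; privates = onto (encodeBool ∘ privateOf ∘ κ) ps } ⟫)
decode-loops v {zero}  κ cs ls ps = stay
decode-loops v {suc n} κ cs ls ps = weaken
  -- The code of vertex zero lies deepest in the reversed list, so its iteration comes after those
  -- of the induction hypothesis.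
  (≤-reflexive (+-comm (decodeTime n) (2 + cost decodeBody)))
  (decode-loops v (κ ∘ suc) _ ls ps ▹ unroll ▹ line decodeBody (decodeBody-exec v (κ zero)))

decode-runs : ∀ {K} v {n} (κ : Fin n → ℕ) →
  (decode ∷ K , ⟪ record v { codes = revOnto (encodeℕ ∘ κ) nil ; labels = nil ; privates = nil } ⟫)
  ⟶[ decodeTime n + 2 ]
  (K , ⟪ record v { codes = nil ; labels = vec (encodeℕ ∘ toℕ ∘ labelOf ∘ κ)
                  ; privates = bitvec (privateOf ∘ κ) } ⟫)
decode-runs {K} v {n} κ = subst₂ Decodes (onto-nil _) (onto-nil _) (decode-loops v κ nil nil nil ▹ unroll)
  where
  Decodes : Tree → Tree → Set
  Decodes ls ps =
    (decode ∷ K , ⟪ record v { codes = revOnto (encodeℕ ∘ κ) nil ; labels = nil ; privates = nil } ⟫)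
    ⟶[ decodeTime n + 2 ]
    (K , ⟪ record v { codes = nil ; labels = ls ; privates = ps } ⟫)

positive : ℕ → Bool
positive zero    = false
positive (suc _) = true

served : ∀ {m n} → Bool → (Fin m → Fin n → Bool) → (Fin m → Bool) → (Fin n → Bool) → Bool
served {zero}  acc a b p = acc
served {suc m} acc a b p =
  served ((not (b zero) ∨ positive (dot 0 (a zero) p)) ∧ acc) (a ∘ suc) (b ∘ suc) p

testRow-exec : ∀ v b k acc {rs bs} →
  exec testRow ⟪ record v { rows = rs ; bits = cons (encodeBool b) bs ; count = encodeℕ k
                          ; ok = encodeBool acc } ⟫
  ≡ ⟪ record v { rows = tail rs ; bits = bs ; count = nil
               ; ok = encodeBool ((not b ∨ positive k) ∧ acc) } ⟫
testRow-exec v false k       acc = refl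
testRow-exec v true  zero    acc = refl
testRow-exec v true  (suc k) acc = refl

verify-runs : ∀ {K} v {m n} (a : Fin m → Fin n → Bool) b (p : Fin n → Bool) acc →
  (verify ∷ K , ⟪ record v { privates = bitvec p ; rows = vec (λ i → bitvec (a i)) ; bits = bitvec b
                           ; row = nil ; col = nil ; count = nil ; ok = encodeBool acc } ⟫)
  ⟶[ rowsTime m n loadPrivates testRow ]
  (K , ⟪ record v { privates = bitvec p ; rows = nil ; bits = nil
                  ; row = nil ; col = nil ; count = nil ; ok = encodeBool (served acc a b p) } ⟫)
verify-runs v {zero}  a b p acc = unroll
verify-runs v {suc m} a b p acc = iterate m
  (unroll ▹ sequence ▹ line loadPrivates refl ▹ sequence ▹
   dot-runs (record v { privates = bitvec p ; rows = vec (λ i → bitvec (a i)) ; bits = bitvec b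
                      ; ok = encodeBool acc }) (a zero) p 0 ▹
   line testRow (testRow-exec
     (record v { privates = bitvec p ; row = nil ; col = nil }) (b zero) (dot 0 (a zero) p) acc))
  (verify-runs v (a ∘ suc) (b ∘ suc) p _)

module _ {n} (G : Graph n) where

  open Graph G using (adj)

  codesOf : (Fin n → Bool) → Fin n → ℕ
  codesOf s = codes-of adj s s

  labelling : (Fin n → Bool) → Labelling n
  labelling s = labelOf ∘ codesOf s

  privateTo : (Fin n → Bool) → Fin n → Bool
  privateTo s = privateOf ∘ codesOf s

  valid : (Fin n → Bool) → Bool
  valid s = served true adj s (privateTo s)

checkTime : ℕ → ℕ
checkTime n = 1 + (cost rewind + (1 + (rowsTime n n loadRow codeRow + (1 + ((decodeTime n + 2) +
  (1 + (cost rewindOk + (1 + (rowsTime n n loadPrivates testRow + cost dropPrivates)))))))))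

blank : Vars
blank = record
  { graph = nil ; set = nil ; labels = nil ; privates = nil ; codes = nil ; rows = nil ; bits = nil
  ; row = nil ; col = nil ; count = nil ; zeros = nil ; rest = nil ; more = nil ; ok = nil }

module Runs {n} (G : Graph n) where

  open Graph G using (adj)

  -- Every scratch variable is nil between passes, so a resting store is described by the few fields
  -- that differ from this one.
  base : Vars
  base = record blank { graph = encodeGraph G }

  check-runs : ∀ {K} z w (s : Fin n → Bool) →
    (check ∷ K , ⟪ record base { zeros = z ; rest = w ; set = bitvec s } ⟫)
    ⟶[ checkTime n ]
    (K , ⟪ record base { zeros = z ; rest = w ; set = bitvec s ; labels = encodeLabelling (labelling G s)
                       ; ok = encodeBool (valid G s) } ⟫)
  check-runs z w s =
    sequence ▹ line rewind refl ▹ sequence ▹ collect-runs v adj s s nil ▹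
    sequence ▹ decode-runs v (codesOf G s) ▹
    sequence ▹ line rewindOk refl ▹
    sequence ▹ verify-runs (record v { labels = encodeLabelling (labelling G s) }) adj s (privateTo G s) true ▹
    line dropPrivates refl
    where
    v = record base { zeros = z ; rest = w ; set = bitvec s }

-- The counter on bit lists: its states, sizes and running time

bitlist : List Bool → Tree
bitlist l = encodeList (map encodeBool l)

bitAt : List Bool → ℕ → Bool
bitAt []      i       = false
bitAt (b ∷ l) zero    = b
bitAt (b ∷ l) (suc i) = bitAt l i

char : ∀ {n} → List Bool → Fin n → Bool
char l i = bitAt l (toℕ i)

bitlist≡bitvec : ∀ {n} l → length l ≡ n → bitlist l ≡ bitvec {n} (char l)
bitlist≡bitvec []      refl = refl
bitlist≡bitvec (b ∷ l) refl = cong (cons (encodeBool b)) (bitlist≡bitvec l refl)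

pad : ℕ → List Bool → List Bool
pad zero    l = l
pad (suc m) l = pad m (false ∷ l)

length-pad : ∀ m l → length (pad m l) ≡ m + length l
length-pad zero    l = refl
length-pad (suc m) l = trans (length-pad m (false ∷ l)) (+-suc m (length l))

padTime : ℕ → ℕ
padTime m = m * (2 + cost padBody) + 2

pad-runs : ∀ {K} v {m} (f : Fin m → Tree) l →
  (pad-loop ∷ K , ⟪ record v { set = bitlist l ; col = vec f } ⟫) ⟶[ padTime m ]
  (K , ⟪ record v { set = bitlist (pad m l) ; col = nil } ⟫)
pad-runs v {zero}  f l = unroll
pad-runs v {suc m} f l =
  unroll ▹ line padBody refl ▹ pad-runs v (f ∘ suc) (false ∷ l)

gate : ∀ {A : Set} → Bool → List A → List A
gate false xs = []
gate true  xs = xs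

size-vec : ∀ {n B} (f : Fin n → Tree) → (∀ i → size (f i) ≤ B) → size (vec f) ≤ 1 + n * (1 + B)
size-vec {zero}  f f≤B = ≤-refl
size-vec {suc n} {B} f f≤B = s≤s (≤-trans
  (+-mono-≤ (f≤B zero) (size-vec (f ∘ suc) (f≤B ∘ suc)))
  (≤-reflexive (+-suc B (n * (1 + B)))))

size-bool : ∀ b → size (encodeBool b) ≤ 3
size-bool false = s≤s z≤n
size-bool true  = ≤-refl

size-label : ∀ (i : Fin 3) → size (encodeℕ (toℕ i)) ≤ 5
size-label 0F = s≤s z≤n
size-label 1F = s≤s (s≤s (s≤s z≤n))
size-label 2F = ≤-refl

size-bitlist : ∀ l → size (bitlist l) ≤ 1 + length l * 4
size-bitlist []      = ≤-refl
size-bitlist (b ∷ l) = s≤s (≤-trans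
  (+-mono-≤ (size-bool b) (size-bitlist l)) (≤-reflexive (+-suc 3 (length l * 4))))

size-graph : ∀ {n} (G : Graph n) → size (encodeGraph G) ≤ 1 + n * (1 + (1 + n * 4))
size-graph G = size-vec _ (λ u → size-vec _ (λ v → size-bool (Graph.adj G u v)))

size-labelling : ∀ {n} (f : Labelling n) → size (encodeLabelling f) ≤ 1 + n * 6
size-labelling f = size-vec _ (λ v → size-label (f v))

-- `baseSize` bounds each tree of a resting store. `gapTime` adds the initial phase to a full search
-- cycle, so that one polynomial covers the first wait and all others.
baseSize tryTime firstTime initTime gapTime : ℕ → ℕ
baseSize n  = (1 + n * (1 + (1 + n * 4))) + (2 + n * 6)
tryTime n   = 2 + (3 + (1 + (cost candidate + (1 + (padTime n +
              (1 + (checkTime n + (cost settle + 2))))))))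
firstTime n = 3 + (1 + (1 + n * 6))
initTime n  = 1 + (cost loadSize + (1 + (padTime n + (1 + (checkTime n + (1 + cost begin-enumeration))))))
gapTime n   = initTime n + ((1 + cost startSearch) + (n * tryTime n + firstTime n))

infixr 5 _∷ᶠ_
_∷ᶠ_ : ∀ {k M t} {σ : Store k} → size t ≤ M → Fits M σ → Fits M (t Vec.∷ σ)
t≤M ∷ᶠ σ-fits = fitting λ { zero → t≤M ; (suc x) → Fits.size-at σ-fits x }

[]ᶠ : ∀ {M} → Fits M Vec.[]
[]ᶠ = fitting λ ()

module Enumeration {n} (G : Graph n) where

  open Runs G

  label-tree : List Bool → Tree
  label-tree l = encodeLabelling (labelling G (char l))

  valid-list : List Bool → Bool
  valid-list l = valid G (char l)

  -- The bits of l are fixed and the m bits below them are free. The gate tests the least set with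
  -- upper bits `true ∷ l`; by heredity its failure rules out all the others.
  listing : ℕ → List Bool → List (List Bool)
  listing zero    l = l ∷ []
  listing (suc m) l =
    listing m (false ∷ l) ++ gate (valid-list (pad m (true ∷ l))) (listing m (true ∷ l))

  found : List Bool → Config 14
  found l = enumerate ∷ [] ,
    ⟪ record base { set = bitlist l ; labels = label-tree l ; more = cons nil nil } ⟫

  -- The counter in mid-carry: the m lower bits are reset, and the next bit to change is sought in
  -- l.
  searching : ℕ → List Bool → Config 14
  searching m l = search ∷ enumerate ∷ [] ,
    ⟪ record base { zeros = vec {m} (λ _ → nil) ; rest = bitlist l } ⟫

  mem : ℕ
  mem = baseSize n + gapTime n

  check-list : ∀ {K} z w l → length l ≡ n →
    (check ∷ K , ⟪ record base { zeros = z ; rest = w ; set = bitlist l } ⟫)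
    ⟶[ checkTime n ]
    (K , ⟪ record base { zeros = z ; rest = w ; set = bitlist l ; labels = label-tree l
                       ; ok = encodeBool (valid-list l) } ⟫)
  check-list {K} z w l len = subst Checks (sym (bitlist≡bitvec l len)) (check-runs z w (char l))
    where
    Checks : Tree → Set
    Checks t =
      (check ∷ K , ⟪ record base { zeros = z ; rest = w ; set = t } ⟫)
      ⟶[ checkTime n ]
      (K , ⟪ record base { zeros = z ; rest = w ; set = t ; labels = label-tree l
                         ; ok = encodeBool (valid-list l) } ⟫)

  tried : ℕ → List Bool → Bool → Config 14
  tried m l false = searching (suc m) l
  tried m l true  = found (pad m (true ∷ l))

  try-runs : ∀ m l → m + length (false ∷ l) ≡ n →
    searching m (false ∷ l) ⟶[ tryTime n ] tried m l (valid-list (pad m (true ∷ l)))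
  try-runs m l len =
    unroll ▹ choose ▹ sequence ▹ line candidate refl ▹ sequence ▹
    weaken padTime≤ (pad-runs (record base { zeros = vec {m} (λ _ → nil) ; rest = bitlist (false ∷ l) })
                      {m} (λ _ → nil) (true ∷ l)) ▹
    sequence ▹ check-list _ _ (pad m (true ∷ l)) (trans (length-pad m (true ∷ l)) len) ▹
    settled (valid-list (pad m (true ∷ l)))
    where
    padTime≤ : padTime m ≤ padTime n
    padTime≤ = +-monoˡ-≤ 2 (*-monoˡ-≤ (2 + cost padBody) (m+n≤o⇒m≤o m (≤-reflexive len)))

    settled : ∀ b →
      (settle ∷ search ∷ enumerate ∷ [] ,
        ⟪ record base { zeros = vec {m} (λ _ → nil) ; rest = bitlist (false ∷ l)
                      ; set = bitlist (pad m (true ∷ l)) ; labels = label-tree (pad m (true ∷ l))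
                      ; ok = encodeBool b } ⟫)
      ⟶[ cost settle + 2 ] tried m l b
    settled false = weaken (m≤m+n (cost settle) 2) (line settle refl)
    settled true  = line settle refl ▹ unroll

  size-bits≤ : ∀ l → length l ≤ n → size (bitlist l) ≤ baseSize n
  size-bits≤ l len = ≤-trans (size-bitlist l) (≤-trans
    (s≤s (≤-trans (*-monoˡ-≤ 4 len) (*-monoʳ-≤ n {4} {6} (≤ᵇ⇒≤ 4 6 _))))
    (≤-trans (n≤1+n _) (m≤n+m _ (1 + n * (1 + (1 + n * 4))))))

  size-zeros≤ : ∀ m → m ≤ n → size (vec {m} (λ _ → nil)) ≤ baseSize n
  size-zeros≤ m m≤n = ≤-trans (size-vec {m} (λ _ → nil) (λ _ → ≤-refl)) (≤-trans
    (s≤s (≤-trans (*-monoˡ-≤ 2 m≤n) (*-monoʳ-≤ n {2} {6} (≤ᵇ⇒≤ 2 6 _))))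
    (≤-trans (n≤1+n _) (m≤n+m _ (1 + n * (1 + (1 + n * 4))))))

  size-graph≤ : size (encodeGraph G) ≤ baseSize n
  size-graph≤ = ≤-trans (size-graph G) (m≤m+n _ _)

  nil≤ : 1 ≤ baseSize n
  nil≤ = s≤s z≤n

  fits-found : ∀ l → length l ≡ n → Fits (baseSize n) (proj₂ (found l))
  fits-found l len =
    size-graph≤ ∷ᶠ size-bits≤ l (≤-reflexive len) ∷ᶠ
    ≤-trans (size-labelling (labelling G (char l)))
      (≤-trans (n≤1+n _) (m≤n+m (2 + n * 6) (1 + n * (1 + (1 + n * 4))))) ∷ᶠ
    nil≤ ∷ᶠ nil≤ ∷ᶠ nil≤ ∷ᶠ nil≤ ∷ᶠ nil≤ ∷ᶠ nil≤ ∷ᶠ nil≤ ∷ᶠ nil≤ ∷ᶠ nil≤ ∷ᶠ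
    s≤s (m≤n⇒m≤o+n (n * (1 + (1 + n * 4))) (s≤s (s≤s z≤n))) ∷ᶠ nil≤ ∷ᶠ []ᶠ

  fits-searching : ∀ m l → m + length l ≡ n → Fits (baseSize n) (proj₂ (searching m l))
  fits-searching m l len =
    size-graph≤ ∷ᶠ nil≤ ∷ᶠ nil≤ ∷ᶠ nil≤ ∷ᶠ nil≤ ∷ᶠ nil≤ ∷ᶠ nil≤ ∷ᶠ nil≤ ∷ᶠ nil≤ ∷ᶠ nil≤ ∷ᶠ
    size-zeros≤ m (m+n≤o⇒m≤o m (≤-reflexive len)) ∷ᶠ
    size-bits≤ l (m+n≤o⇒n≤o m (≤-reflexive len)) ∷ᶠ nil≤ ∷ᶠ nil≤ ∷ᶠ []ᶠ

  fits-start : Fits (baseSize n) ⟪ base ⟫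
  fits-start =
    size-graph≤ ∷ᶠ nil≤ ∷ᶠ nil≤ ∷ᶠ nil≤ ∷ᶠ nil≤ ∷ᶠ nil≤ ∷ᶠ nil≤ ∷ᶠ nil≤ ∷ᶠ nil≤ ∷ᶠ nil≤ ∷ᶠ
    nil≤ ∷ᶠ nil≤ ∷ᶠ nil≤ ∷ᶠ nil≤ ∷ᶠ []ᶠ

  cycle : ℕ
  cycle = (1 + cost startSearch) + (n * tryTime n + firstTime n)

  cycle≤gap : cycle ≤ gapTime n
  cycle≤gap = m≤n+m cycle (initTime n)

  try≤cycle : ∀ k → suc k ≤ n → tryTime n ≤ cycle
  try≤cycle k k<n = m≤n⇒m≤o+n (1 + cost startSearch) (m≤n⇒m≤n+o (firstTime n)
    (≤-trans (m≤m*n (tryTime n) n {{>-nonZero (≤-trans (s≤s z≤n) k<n)}})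
      (≤-reflexive (*-comm (tryTime n) n))))

  fits-mem : ∀ {t} → t ≤ gapTime n → baseSize n + t ≤ mem
  fits-mem = +-monoʳ-≤ (baseSize n)

  searchTime : ℕ → ℕ
  searchTime k = k * tryTime n + firstTime n

  -- In continuation form: the hypothesis traces what happens after the carry out of the m lower
  -- bits. The recursion can thus follow `listing` although runs are built from their end. The wait
  -- after the carry is charged at one try per bit of l.
  enumerates : ∀ m l → m + length l ≡ n → ∀ {out} →
    Trace (searching m l) out (searchTime (length l)) (gapTime n) mem →
    Trace (found (pad m l)) (map label-tree (listing m l) ++ out) (firstTime n) (gapTime n) mem
  enumerates zero l len τ = trace-weaken
    (s≤s (s≤s (s≤s (s≤s (size-labelling (labelling G (char l)))))))
    (trace-step (unroll ▹ sequence) small (fits-mem (≤-trans (s≤s (s≤s (s≤s z≤n))) cycle≤gap))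
      (trace-emit (fits-mono (m≤m+n _ _) small)
        (≤-trans (+-monoʳ-≤ (1 + cost startSearch)
          (+-monoˡ-≤ (firstTime n) (*-monoˡ-≤ (tryTime n) (≤-reflexive len)))) cycle≤gap)
        (trace-step (sequence ▹ line startSearch refl) small
          (fits-mem (≤-trans (m≤m+n _ _) cycle≤gap)) τ)))
    where
    small = fits-found l len
  enumerates (suc m) l len {out} τ =
    subst (λ o → Trace (found (pad m (false ∷ l))) o (firstTime n) (gapTime n) mem)
      (sym (trans (cong (_++ out) (map-++ label-tree (listing m (false ∷ l)) _))
        (++-assoc (map label-tree (listing m (false ∷ l))) _ out)))
      (enumerates m (false ∷ l) len′
        (trace-weaken (≤-reflexive (sym (+-assoc (tryTime n) _ _)))
        -- When the sets with this bit `false` are done, the carry reaches the bit and tries to set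
        -- it.
        (trace-step (try-runs m l len′) (fits-searching m (false ∷ l) len′) (fits-mem try≤)
          (after (valid-list (pad m (true ∷ l)))))))
    where
    len′ : m + suc (length l) ≡ n
    len′ = trans (+-suc m (length l)) len

    try≤ : tryTime n ≤ gapTime n
    try≤ = ≤-trans (try≤cycle (length l) (m+n≤o⇒n≤o m (≤-reflexive len′))) cycle≤gap

    advanceTime≤ : 2 + (3 + cost advance) ≤ tryTime n
    advanceTime≤ = +-monoʳ-≤ 5
      (≤-trans (≤ᵇ⇒≤ (cost advance) (1 + cost candidate) _) (m≤m+n (1 + cost candidate) _))

    after : ∀ b →
      Trace (tried m l b) (map label-tree (gate b (listing m (true ∷ l))) ++ out)
        (searchTime (length l)) (gapTime n) mem
    after false = τ
    -- After the sets with this bit `true` the counter resets the bit, and arrives at the same carry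
    -- as after a rejection.
    after true  = trace-weaken (m≤n+m (firstTime n) (length l * tryTime n))
      (enumerates m (true ∷ l) len′
        (trace-weaken (≤-trans (+-monoˡ-≤ _ advanceTime≤) (≤-reflexive (sym (+-assoc (tryTime n) _ _))))
        (trace-step (unroll ▹ choose ▹ line advance refl) (fits-searching m (true ∷ l) len′)
          (fits-mem (≤-trans advanceTime≤ try≤)) τ)))

  -- The carry leaves the top bit: with `rest` and `more` both nil, the two loops end.
  exhausted : Trace (searching n []) [] (searchTime 0) (gapTime n) mem
  exhausted = trace-weaken (s≤s (s≤s (s≤s (s≤s z≤n))))
    (trace-step (unroll ▹ unroll) small (fits-mem (≤-trans (s≤s (s≤s (s≤s (s≤s z≤n)))) cycle≤gap))
      (trace-halt (fits-mono (m≤m+n _ _) small)))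
    where
    small = fits-searching n [] (+-identityʳ n)

  enumeration : Trace (start program (encodeGraph G)) (map label-tree (listing n []))
                  (gapTime n) (gapTime n) mem
  enumeration = trace-weaken
    (+-monoʳ-≤ (initTime n) (m≤n⇒m≤o+n (1 + cost startSearch) (m≤n+m (firstTime n) (n * tryTime n))))
    (trace-step
      (sequence ▹ line loadSize refl ▹ sequence ▹
       pad-runs base (λ u → vec (λ v → encodeBool (Graph.adj G u v))) [] ▹
       sequence ▹ check-list nil nil (pad n []) (trans (length-pad n []) (+-identityʳ n)) ▹
       sequence ▹ line begin-enumeration refl)
      fits-start (fits-mem (m≤m+n _ _))
      (subst (λ o → Trace (found (pad n [])) o (firstTime n) (gapTime n) mem) (++-identityʳ _)
        (enumerates n [] (+-identityʳ n) exhausted)))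

-- Minimal Roman dominating functions

true≢false : ∀ {b} → b ≡ true → b ≢ false
true≢false refl ()

0≢1 : _≢_ {A = Fin 3} 0F 1F
0≢1 ()

0≢2 : _≢_ {A = Fin 3} 0F 2F
0≢2 ()

1≢2 : _≢_ {A = Fin 3} 1F 2F
1≢2 ()

-- `code` distinguishes no more than zero, one and several common elements; each case carries its
-- witnesses.
data Hits {n} (a b : Fin n → Bool) : ℕ → Set where
  no-hit    : (∀ i → a i ≡ true → b i ≡ true → ⊥) → Hits a b 0
  one-hit   : ∀ i → a i ≡ true → b i ≡ true →
              (∀ j → a j ≡ true → b j ≡ true → j ≡ i) → Hits a b 1
  many-hits : ∀ i j {k} → i ≢ j → a i ≡ true → b i ≡ true → a j ≡ true → b j ≡ true →
              Hits a b (2 + k)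

dot-suc : ∀ acc {n} (a b : Fin n → Bool) → dot (suc acc) a b ≡ suc (dot acc a b)
dot-suc acc {zero}  a b = refl
dot-suc acc {suc n} a b with a zero ∧ b zero
... | false = dot-suc acc (a ∘ suc) (b ∘ suc)
... | true  = dot-suc (suc acc) (a ∘ suc) (b ∘ suc)

hits-suc : ∀ {n k} {a b : Fin (suc n) → Bool} → (a zero ≡ true → b zero ≡ true → ⊥) →
           Hits (a ∘ suc) (b ∘ suc) k → Hits a b k
hits-suc ¬0 (no-hit ¬h) = no-hit λ { zero → ¬0 ; (suc j) → ¬h j }
hits-suc ¬0 (one-hit i p q only) = one-hit (suc i) p q λ
  { zero p₀ q₀ → ⊥-elim (¬0 p₀ q₀) ; (suc j) p q → cong suc (only j p q) }
hits-suc ¬0 (many-hits i j i≢j p q p′ q′) =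
  many-hits (suc i) (suc j) (i≢j ∘ suc-injective) p q p′ q′

hits-zero : ∀ {n k} {a b : Fin (suc n) → Bool} → a zero ≡ true → b zero ≡ true →
            Hits (a ∘ suc) (b ∘ suc) k → Hits a b (suc k)
hits-zero p₀ q₀ (no-hit ¬h)               =
  one-hit zero p₀ q₀ λ { zero _ _ → refl ; (suc j) p q → ⊥-elim (¬h j p q) }
hits-zero p₀ q₀ (one-hit i p q _)         = many-hits zero (suc i) (λ ()) p₀ q₀ p q
hits-zero p₀ q₀ (many-hits i _ _ p q _ _) = many-hits zero (suc i) (λ ()) p₀ q₀ p q

hits : ∀ {n} (a b : Fin n → Bool) → Hits a b (dot 0 a b)
hits {zero}  a b = no-hit λ ()
hits {suc n} a b with a zero in a₀ | b zero in b₀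
... | false | _     = hits-suc (λ p _ → true≢false p a₀) (hits (a ∘ suc) (b ∘ suc))
... | true  | false = hits-suc (λ _ q → true≢false q b₀) (hits (a ∘ suc) (b ∘ suc))
... | true  | true  = subst (Hits a b) (sym (dot-suc 0 (a ∘ suc) (b ∘ suc)))
  (hits-zero a₀ b₀ (hits (a ∘ suc) (b ∘ suc)))

positive-hits : ∀ {n k} {a b : Fin n → Bool} → Hits a b k → positive k ≡ true →
                ∃[ i ] (a i ≡ true × b i ≡ true)
positive-hits (one-hit i p q _)         _ = i , p , q
positive-hits (many-hits i _ _ p q _ _) _ = i , p , q

hits-positive : ∀ {n k} {a b : Fin n → Bool} → Hits a b k →
                ∃[ i ] (a i ≡ true × b i ≡ true) → positive k ≡ true
hits-positive (no-hit ¬h)               (i , p , q) = ⊥-elim (¬h i p q)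
hits-positive (one-hit _ _ _ _)         _           = refl
hits-positive (many-hits _ _ _ _ _ _ _) _           = refl

∧-true : ∀ {a b} → a ∧ b ≡ true → a ≡ true × b ≡ true
∧-true {true} p = refl , p

implication : ∀ {a b} → not a ∨ b ≡ true → a ≡ true → b ≡ true
implication p refl = p

served⇒acc : ∀ {m n} acc (a : Fin m → Fin n → Bool) b p → served acc a b p ≡ true → acc ≡ true
served⇒acc {zero}  acc a b p eq = eq
served⇒acc {suc m} acc a b p eq = proj₂ (∧-true
  (served⇒acc ((not (b zero) ∨ positive (dot 0 (a zero) p)) ∧ acc) (a ∘ suc) (b ∘ suc) p eq))

served⇒ : ∀ {m n} acc (a : Fin m → Fin n → Bool) b p → served acc a b p ≡ true →
          ∀ i → b i ≡ true → ∃[ j ] (a i j ≡ true × p j ≡ true)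
served⇒ acc a b p eq (suc i) bi = served⇒ _ (a ∘ suc) (b ∘ suc) p eq i bi
served⇒ acc a b p eq zero    b₀
  with h , _ ← ∧-true (served⇒acc ((not (b zero) ∨ positive (dot 0 (a zero) p)) ∧ acc) (a ∘ suc) (b ∘ suc) p eq)
  = positive-hits (hits (a zero) p) (implication h b₀)

served⇐ : ∀ {m n} (a : Fin m → Fin n → Bool) b p →
          (∀ i → b i ≡ true → ∃[ j ] (a i j ≡ true × p j ≡ true)) → served true a b p ≡ true
served⇐ {zero}  a b p f = refl
served⇐ {suc m} a b p f with b zero in b₀
... | false = served⇐ (a ∘ suc) (b ∘ suc) p (f ∘ suc)
... | true rewrite hits-positive (hits (a zero) p) (f zero b₀) = served⇐ (a ∘ suc) (b ∘ suc) p (f ∘ suc)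

module Minimal {n} (G : Graph n) where

  open Graph G using (adj; Adjacent)
  open Count G using (HasPrivates; adjacent-sym; adjacent-irrefl)

  selected : ∀ {s u} → s u ≡ true → labelling G s u ≡ 2F
  selected {s} {u} su rewrite su = refl

  dominated : ∀ {s u v} → s u ≡ false → Adjacent u v → s v ≡ true → labelling G s u ≡ 0F
  dominated {s} {u} {v} su uv sv rewrite su with dot 0 (adj u) s | hits (adj u) s
  ... | _ | no-hit ¬h                = ⊥-elim (¬h v uv sv)
  ... | _ | one-hit _ _ _ _          = refl
  ... | _ | many-hits _ _ _ _ _ _ _  = refl

  undominated : ∀ {s u} → s u ≡ false → (∀ v → Adjacent u v → s v ≡ true → ⊥) → labelling G s u ≡ 1F
  undominated {s} {u} su none rewrite su with dot 0 (adj u) s | hits (adj u) s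
  ... | _ | no-hit _                 = refl
  ... | _ | one-hit v uv sv _        = ⊥-elim (none v uv sv)
  ... | _ | many-hits v _ _ uv sv _ _ = ⊥-elim (none v uv sv)

  data Role (s : Fin n → Bool) (u : Fin n) : Fin 3 → Set where
    role-2 : s u ≡ true → Role s u 2F
    role-0 : ∀ {v} → s u ≡ false → Adjacent u v → s v ≡ true → Role s u 0F
    role-1 : s u ≡ false → (∀ v → Adjacent u v → s v ≡ true → ⊥) → Role s u 1F

  role : ∀ s u → Role s u (labelling G s u)
  role s u with s u in su
  ... | true = role-2 su
  ... | false with dot 0 (adj u) s | hits (adj u) s
  ...   | _ | no-hit ¬h                 = role-1 su ¬h
  ...   | _ | one-hit v uv sv _         = role-0 su uv sv
  ...   | _ | many-hits v _ _ uv sv _ _ = role-0 su uv sv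

  private-true : ∀ {s u v} → s u ≡ false → Adjacent u v → s v ≡ true →
    (∀ w → s w ≡ true → Adjacent u w → w ≡ v) → privateTo G s u ≡ true
  private-true {s} {u} {v} su uv sv only rewrite su with dot 0 (adj u) s | hits (adj u) s
  ... | _ | no-hit ¬h                        = ⊥-elim (¬h v uv sv)
  ... | _ | one-hit _ _ _ _                  = refl
  ... | _ | many-hits i j i≢j ui si uj sj    = ⊥-elim (i≢j (trans (only i si ui) (sym (only j sj uj))))

  private-only : ∀ {s u} → privateTo G s u ≡ true →
    s u ≡ false × (∀ v w → Adjacent u v → s v ≡ true → Adjacent u w → s w ≡ true → w ≡ v)
  private-only {s} {u} p with s u
  ... | false with dot 0 (adj u) s | hits (adj u) s
  ...   | _ | one-hit i _ _ only = refl , λ v w uv sv uw sw → trans (only w uw sw) (sym (only v uv sv))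

  valid⇒privates : ∀ s → valid G s ≡ true → HasPrivates s
  valid⇒privates s ok v sv with x , vx , px ← served⇒ true adj s (privateTo G s) ok v sv
    with sx , only ← private-only px =
    x , adjacent-sym vx , sx , λ w sw xw → only v w (adjacent-sym vx) sv xw sw

  privates⇒valid : ∀ s → HasPrivates s → valid G s ≡ true
  privates⇒valid s privates = served⇐ adj s (privateTo G s) λ v sv →
    let x , xv , sx , only = privates v sv in x , adjacent-sym xv , private-true sx xv sv only

  -- The same private neighbours serve the smaller set: x stays unselected and gains no selected
  -- neighbour.
  privates-mono : ∀ {s t} → (∀ i → t i ≡ true → s i ≡ true) → HasPrivates s → HasPrivates t
  privates-mono t⊆s privates v tv with x , xv , sx , only ← privates v (t⊆s v tv) =
    x , xv , ¬-not (λ tx → true≢false (t⊆s x tx) sx) , λ w tw → only w (t⊆s w tw)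

  labelling-rdf : ∀ s → IsRDF G (labelling G s)
  labelling-rdf s v fv≡0 with labelling G s v | role s v
  labelling-rdf s v fv≡0 | _ | role-0 {u} _ vu su = u , vu , selected su
  labelling-rdf s v ()   | _ | role-2 _
  labelling-rdf s v ()   | _ | role-1 _ _

  2F-selected : ∀ {s u} → labelling G s u ≡ 2F → s u ≡ true
  2F-selected {s} {u} fu≡2 with labelling G s u | role s u
  2F-selected fu≡2 | _ | role-2 su    = su
  2F-selected ()   | _ | role-0 _ _ _
  2F-selected ()   | _ | role-1 _ _

  ≥2⇒≡2 : ∀ {i : Fin 3} → 2 ≤ toℕ i → i ≡ 2F
  ≥2⇒≡2 {2F} _ = refl
  ≥2⇒≡2 {1F} (s≤s ())

  -- A label 2 at v cannot drop: a private neighbour of v keeps the label 0, and v is the only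
  -- neighbour of it that can still carry 2. A label 1 cannot drop to 0, because no neighbour is
  -- selected.
  labelling-minimal : ∀ {s} → HasPrivates s → IsMinimalRDF G (labelling G s)
  labelling-minimal {s} privates = labelling-rdf s , λ (g , g-rdf , g≢f , g≼f) → g≢f (λ v → same g g-rdf g≼f v)
    where
    module _ (g : Labelling n) (g-rdf : IsRDF G g) (g≼f : g ≼ labelling G s) where

      g-selected : ∀ {u} → g u ≡ 2F → s u ≡ true
      g-selected {u} gu≡2 = 2F-selected (≥2⇒≡2 (subst (Fin._≤ labelling G s u) gu≡2 (g≼f u)))

      neighbour : ∀ v → g v ≡ 0F → ∃[ u ] (Adjacent v u × s u ≡ true × g u ≡ 2F)
      neighbour v gv≡0 with u , vu , gu≡2 ← g-rdf v gv≡0 = u , vu , g-selected gu≡2 , gu≡2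

      ≤0⇒≡0 : ∀ {i : Fin 3} → i Fin.≤ zero {2} → i ≡ 0F
      ≤0⇒≡0 {0F} _ = refl

      2-kept : ∀ v → s v ≡ true → g v ≡ 2F
      2-kept v sv with x , xv , sx , only ← privates v sv
        with u , xu , su , gu≡2 ← neighbour x
          (≤0⇒≡0 (subst (g x Fin.≤_) (dominated sx xv sv) (g≼f x)))
        with refl ← only u su xu = gu≡2

      1-kept : ∀ v → (∀ u → Adjacent v u → s u ≡ true → ⊥) → g v Fin.≤ suc (zero {1}) → g v ≡ 1F
      1-kept v none gv≤1 with g v in gv
      1-kept v none gv≤1 | 0F with u , vu , su , _ ← neighbour v gv = ⊥-elim (none u vu su)
      1-kept v none gv≤1 | 1F = refl
      1-kept v none (s≤s ()) | 2F

      same : ∀ v → g v ≡ labelling G s v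
      same v with labelling G s v | role s v | g≼f v
      ... | _ | role-2 sv      | _    = 2-kept v sv
      ... | _ | role-0 _ _ _   | gv≤0 = ≤0⇒≡0 gv≤0
      ... | _ | role-1 _ none  | gv≤1 = 1-kept v none gv≤1

  lower : Labelling n → Fin n → Fin 3 → Labelling n
  lower f v k i with i ≟ v
  ... | yes _ = k
  ... | no _  = f i

  lower-at : ∀ f v k → lower f v k v ≡ k
  lower-at f v k with v ≟ v
  ... | yes _  = refl
  ... | no v≢v = contradiction refl v≢v

  lower-off : ∀ f {v i} k → i ≢ v → lower f v k i ≡ f i
  lower-off f {v} {i} k i≢v with i ≟ v
  ... | yes i≡v = contradiction i≡v i≢v
  ... | no _    = refl

  lower-≼ : ∀ f {v k} → k Fin.≤ f v → lower f v k ≼ f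
  lower-≼ f {v} k≤fv i with i ≟ v
  ... | yes refl = k≤fv
  ... | no _     = ≤-refl

  twos : Labelling n → Fin n → Bool
  twos f v = does (f v ≟ 2F)

  twos-true : ∀ f {v} → twos f v ≡ true → f v ≡ 2F
  twos-true f {v} p with f v ≟ 2F
  ... | yes fv≡2 = fv≡2

  twos-false : ∀ f {v} → twos f v ≡ false → f v ≢ 2F
  twos-false f {v} p fv≡2 = true≢false (dec-true (f v ≟ 2F) fv≡2) p

  module _ {f : Labelling n} (f-minimal : IsMinimalRDF G f) where

    s = twos f

    ¬lower : ∀ {v k} → k Fin.≤ f v → k ≢ f v → ¬ IsRDF G (lower f v k)
    ¬lower {v} {k} k≤fv k≢fv rdf = proj₂ f-minimal
      (lower f v k , rdf , (λ same → k≢fv (trans (sym (lower-at f v k)) (same v))) , lower-≼ f k≤fv)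

    private-vertex? : ∀ v → Dec (∃[ x ] (Adjacent x v × s x ≡ false ×
      ¬ (∃[ w ] (s w ≡ true × Adjacent x w × w ≢ v))))
    private-vertex? v = any? λ x → (adj x v Bool.≟ true) ×-dec (s x Bool.≟ false) ×-dec
      ¬? (any? λ w → (s w Bool.≟ true) ×-dec (adj x w Bool.≟ true) ×-dec ¬? (w ≟ v))

    -- Otherwise lowering v from 2 to 1 would leave a Roman dominating function. With label 1, v
    -- itself needs no neighbour labelled 2, which is why the private neighbour can be taken
    -- external.
    minimal⇒privates : HasPrivates s
    minimal⇒privates v sv with private-vertex? v
    ... | yes (x , xv , sx , others) = x , xv , sx ,
      λ w sw xw → decidable-stable (w ≟ v) λ w≢v → others (w , sw , xw , w≢v)
    ... | no none = ⊥-elim (¬lower (subst (λ i → 1 ≤ toℕ i) (sym fv≡2) (s≤s z≤n))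
                      (λ 1≡fv → 1≢2 (trans 1≡fv fv≡2)) rdf)
      where
      fv≡2 : f v ≡ 2F
      fv≡2 = twos-true f sv

      rdf : IsRDF G (lower f v 1F)
      rdf x gx≡0 with x ≟ v
      rdf x ()   | yes _
      rdf x fx≡0 | no x≢v with u , xu , fu≡2 ← proj₁ f-minimal x fx≡0 with u ≟ v
      ... | no u≢v   = u , xu , trans (lower-off f 1F u≢v) fu≡2
      -- The neighbour labelled 2 was v: another one takes over, or x is private to v.
      ... | yes refl with any? (λ w → (s w Bool.≟ true) ×-dec (adj x w Bool.≟ true) ×-dec ¬? (w ≟ v))
      ...   | yes (w , sw , xw , w≢v) = w , xw , trans (lower-off f 1F w≢v) (twos-true f sw)
      ...   | no others = ⊥-elim (none (x , xu , dec-false (f x ≟ 2F) (λ fx≡2 → 0≢2 (trans (sym fx≡0) fx≡2)) , others))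

    -- A vertex labelled 1 next to a vertex labelled 2 could be lowered to 0.
    one-isolated : ∀ u → f u ≡ 1F → ∀ v → Adjacent u v → s v ≡ true → ⊥
    one-isolated u fu≡1 v uv sv = ¬lower z≤n (λ 0≡fu → 0≢1 (trans 0≡fu fu≡1)) rdf
      where
      kept : ∀ {w} → f w ≡ 2F → lower f u 0F w ≡ 2F
      kept {w} fw≡2 = trans (lower-off f 0F λ { refl → 1≢2 (trans (sym fu≡1) fw≡2) }) fw≡2

      rdf : IsRDF G (lower f u 0F)
      rdf x gx≡0 with x ≟ u
      ... | yes refl = v , uv , kept (twos-true f sv)
      ... | no _ with w , xw , fw≡2 ← proj₁ f-minimal x gx≡0 = w , xw , kept fw≡2

    minimal-labelling : f ≗ labelling G s
    minimal-labelling u with labelling G s u | role s u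
    ... | _ | role-2 su          = twos-true f su
    ... | _ | role-1 su none with twos-false f su | f u in fu
    ...   | _ | 0F with v , uv , fv≡2 ← proj₁ f-minimal u fu = ⊥-elim (none v uv (dec-true (f v ≟ 2F) fv≡2))
    ...   | _ | 1F = refl
    ...   | ¬2 | 2F = ⊥-elim (¬2 fu)
    minimal-labelling u | _ | role-0 {v} su uv sv with twos-false f su | f u in fu
    ...   | _ | 0F = refl
    ...   | _ | 1F = ⊥-elim (one-isolated u fu v uv sv)
    ...   | ¬2 | 2F = ⊥-elim (¬2 fu)

-- Correctness of the listing and injectivity of the encodings

char-injective : ∀ {n} l l′ → length l ≡ n → length l′ ≡ n →
  (∀ (i : Fin n) → char l i ≡ char l′ i) → l ≡ l′
char-injective []      []       _    _   eq = refl
char-injective (b ∷ l) (b′ ∷ l′) refl len eq =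
  cong₂ _∷_ (eq zero) (char-injective l l′ refl (cong pred len) (eq ∘ suc))
char-injective []      (b ∷ l′)  refl () eq
char-injective (b ∷ l) []        refl () eq

char-tabulate : ∀ {n} (s : Fin n → Bool) i → char (tabulate s) i ≡ s i
char-tabulate s zero    = refl
char-tabulate s (suc i) = char-tabulate (s ∘ suc) i

Below : List Bool → List Bool → Set
Below l l′ = ∀ i → bitAt l i ≡ true → bitAt l′ i ≡ true

-- `ʳ++` puts the head of w deepest, as `listing` fixes the upper bits first; padding with `false`
-- gives the least set with given upper bits.
pad-below : ∀ w {l l′} → Below l l′ → Below (pad (length w) l) (w ʳ++ l′)
pad-below []      l≤l′ = l≤l′
pad-below (b ∷ w) l≤l′ = pad-below w λ { zero () ; (suc i) → l≤l′ i }

pad-empty : ∀ m {l} → (∀ i → bitAt l i ≡ false) → ∀ i → bitAt (pad m l) i ≡ false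
pad-empty zero    l≡0 = l≡0
pad-empty (suc m) l≡0 = pad-empty m λ { zero → refl ; (suc i) → l≡0 i }

ʳ++-cancel : ∀ {A : Set} (w w′ : List A) {l l′} → length w ≡ length w′ → w ʳ++ l ≡ w′ ʳ++ l′ → l ≡ l′
ʳ++-cancel []      []       _   eq = eq
ʳ++-cancel (b ∷ w) (b′ ∷ w′) len eq with refl ← ʳ++-cancel w w′ (cong pred len) eq = refl

cons-injective : ∀ {s s′ t t′} → Tree.cons s t ≡ cons s′ t′ → s ≡ s′ × t ≡ t′
cons-injective refl = refl , refl

vec-injective : ∀ {n} {f g : Fin n → Tree} → vec f ≡ vec g → f ≗ g
vec-injective {suc n} eq zero    = proj₁ (cons-injective eq)
vec-injective {suc n} eq (suc i) = vec-injective (proj₂ (cons-injective eq)) i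

encodeℕ-injective : ∀ {m n} → encodeℕ m ≡ encodeℕ n → m ≡ n
encodeℕ-injective {zero}  {zero}  eq = refl
encodeℕ-injective {suc m} {suc n} eq = cong suc (encodeℕ-injective (proj₂ (cons-injective eq)))

vec-cong : ∀ {n} {f g : Fin n → Tree} → f ≗ g → vec f ≡ vec g
vec-cong {zero}  f≗g = refl
vec-cong {suc n} f≗g = cong₂ cons (f≗g zero) (vec-cong (f≗g ∘ suc))

encodeLabelling-cong : ∀ {n} {f g : Labelling n} → f ≗ g → encodeLabelling f ≡ encodeLabelling g
encodeLabelling-cong f≗g = vec-cong λ v → cong (encodeℕ ∘ toℕ) (f≗g v)

encodeLabelling-injective : ∀ {n} {f g : Labelling n} → encodeLabelling f ≡ encodeLabelling g → f ≗ g
encodeLabelling-injective eq v = toℕ-injective (encodeℕ-injective (vec-injective eq v))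

∈-gate⁻ : ∀ {A : Set} b {x : A} {xs} → x ∈ gate b xs → b ≡ true × x ∈ xs
∈-gate⁻ true p = refl , p

module Listing {n} (G : Graph n) where

  open Minimal G
  open Enumeration G
  open Count G using (HasPrivates)

  listed : ∀ m l {x} → x ∈ listing m l → ∃[ w ] (length w ≡ m × x ≡ w ʳ++ l)
  listed zero    l (here x≡l) = [] , refl , x≡l
  listed (suc m) l x∈ with ∈-++⁻ (listing m (false ∷ l)) x∈
  ... | inj₁ p with w , len , eq ← listed m (false ∷ l) p = false ∷ w , cong suc len , eq
  ... | inj₂ p with w , len , eq ← listed m (true ∷ l) (proj₂ (∈-gate⁻ _ p)) =
    true ∷ w , cong suc len , eq

  listing-valid : ∀ m l → valid-list (pad m l) ≡ true → All (λ x → valid-list x ≡ true) (listing m l)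
  listing-valid zero    l ok = ok ∷ []
  listing-valid (suc m) l ok = All.++⁺ (listing-valid m (false ∷ l) ok) (gated _ refl)
    where
    gated : ∀ b → valid-list (pad m (true ∷ l)) ≡ b →
            All (λ x → valid-list x ≡ true) (gate b (listing m (true ∷ l)))
    gated false _   = []
    gated true  ok′ = listing-valid m (true ∷ l) ok′

  valid-below : ∀ {l l′} → Below l l′ → valid-list l′ ≡ true → valid-list l ≡ true
  valid-below l≤l′ ok = privates⇒valid _ (privates-mono (λ i → l≤l′ (toℕ i)) (valid⇒privates _ ok))

  -- At a `true` bit the gate is open, because the set tested there is contained in the wanted one,
  -- which is valid.
  listing-complete : ∀ w l → valid-list (w ʳ++ l) ≡ true → w ʳ++ l ∈ listing (length w) l
  listing-complete []          l ok = here refl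
  listing-complete (false ∷ w) l ok = ∈-++⁺ˡ (listing-complete w (false ∷ l) ok)
  listing-complete (true ∷ w)  l ok = ∈-++⁺ʳ (listing (length w) (false ∷ l))
    (subst (λ b → w ʳ++ (true ∷ l) ∈ gate b (listing (length w) (true ∷ l)))
      (sym (valid-below {pad (length w) (true ∷ l)} {w ʳ++ (true ∷ l)}
        (pad-below w {true ∷ l} {true ∷ l} (λ _ p → p)) ok)) (listing-complete w (true ∷ l) ok))

  listing-unique : ∀ m l → Unique (listing m l)
  listing-unique zero    l = [] ∷ []
  listing-unique (suc m) l = Unique.++⁺ (listing-unique m (false ∷ l)) (gated _) disjoint
    where
    gated : ∀ b → Unique (gate b (listing m (true ∷ l)))
    gated false = []
    gated true  = listing-unique m (true ∷ l)

    disjoint : ∀ {x} → ¬ (x ∈ listing m (false ∷ l) × x ∈ gate _ (listing m (true ∷ l)))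
    disjoint (p , q) with w , len , refl ← listed m (false ∷ l) p
      with w′ , len′ , eq ← listed m (true ∷ l) (proj₂ (∈-gate⁻ _ q))
      -- Equal lists would have equal parts above the m free bits, yet these begin with `false` and
      -- `true`.
      with () ← ʳ++-cancel w w′ (trans len (sym len′)) eq

  sets : List (List Bool)
  sets = listing n []

  sets-length : All (λ x → length x ≡ n) sets
  sets-length = All.tabulate λ {x} x∈ → let w , len , eq = listed n [] x∈ in
    trans (cong length eq) (trans (length-reverse w) len)

  sets-valid : All (λ x → valid-list x ≡ true) sets
  sets-valid = listing-valid n [] (privates⇒valid _ λ v sv →
    ⊥-elim (true≢false sv (pad-empty n (λ _ → refl) (toℕ v))))

  sets-complete : ∀ x → length x ≡ n → valid-list x ≡ true → x ∈ sets
  sets-complete x len ok = subst₂ (λ y m → y ∈ listing m [])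
    (reverse-involutive x) (trans (length-reverse x) len)
    (listing-complete (reverse x) [] (subst (λ y → valid-list y ≡ true) (sym (reverse-involutive x)) ok))

  sets-differ : AllPairs (λ x y → ∃[ i ] char {n} x i ≢ char y i) sets
  sets-differ = allPairs-mapWith differ sets-length (listing-unique n [])
    where
    differ : ∀ {x y} → length x ≡ n → length y ≡ n → x ≢ y → ∃[ i ] char {n} x i ≢ char y i
    differ {x} {y} lx ly x≢y = decidable-stable
      (any? λ i → ¬? (char x i Bool.≟ char y i)) λ none →
      x≢y (char-injective x y lx ly λ i → decidable-stable (char x i Bool.≟ char y i) λ ne → none (i , ne))

  sets-count : length sets * 10000 ^ n ≤ 19332 ^ n
  sets-count = subst (λ k → k * 10000 ^ n ≤ 19332 ^ n) (length-map char sets)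
    (Count.count G (map char sets) (AllPairs.map⁺ sets-differ)
      (All.map⁺ (All.map (valid⇒privates _) sets-valid)))

  -- The selected vertices are those labelled 2, so a labelling determines its set.
  labels-unique : Unique (map label-tree sets)
  labels-unique = AllPairs.map⁺ (AllPairs.map (λ {x} {y} → distinct x y) sets-differ)
    where
    distinct : ∀ x y → (∃[ i ] char {n} x i ≢ char y i) → label-tree x ≢ label-tree y
    distinct x y (i , ne) eq = ne (⇔→≡ (mk⇔
      (λ xi → 2F-selected {char y} {i} (trans (sym (encodeLabelling-injective eq i)) (selected {char x} {i} xi)))
      (λ yi → 2F-selected {char x} {i} (trans (encodeLabelling-injective eq i) (selected {char y} {i} yi)))))

  labels-correct : ∀ t → t ∈ map label-tree sets ⇔ (∃[ f ] (IsMinimalRDF G f × t ≡ encodeLabelling f))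
  labels-correct t = mk⇔ sound complete
    where
    sound : t ∈ map label-tree sets → ∃[ f ] (IsMinimalRDF G f × t ≡ encodeLabelling f)
    sound t∈ with x , x∈ , t≡ ← ∈-map⁻ label-tree t∈ =
      labelling G (char x) , labelling-minimal (valid⇒privates _ (All.lookup sets-valid x∈)) , t≡

    complete : (∃[ f ] (IsMinimalRDF G f × t ≡ encodeLabelling f)) → t ∈ map label-tree sets
    complete (f , minimal , refl) = subst (_∈ map label-tree sets)
      (sym (encodeLabelling-cong f≗)) (∈-map⁺ label-tree (sets-complete x (length-tabulate (twos f))
        (privates⇒valid _ (privates-mono (λ i p → trans (sym (char-tabulate (twos f) i)) p)
          (minimal⇒privates minimal)))))
      where
      x : List Bool
      x = tabulate (twos f)

      f≗ : f ≗ labelling G (char x)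
      -- `char x` agrees with `twos f` only pointwise, so the labellings of the two are compared
      -- role by role instead of by rewriting.
      f≗ u with labelling G (char x) u | role (char x) u
      ... | _ | role-2 su       = twos-true f (trans (sym (char-tabulate (twos f) u)) su)
      ... | _ | role-0 {v} su uv sv = trans (minimal-labelling minimal u)
        (dominated (trans (sym (char-tabulate (twos f) u)) su) uv (trans (sym (char-tabulate (twos f) v)) sv))
      ... | _ | role-1 su none  = trans (minimal-labelling minimal u)
        (undominated (trans (sym (char-tabulate (twos f) u)) su)
          λ v uv sv → none v uv (trans (char-tabulate (twos f) v) sv))

-- Polynomial expressions

IsPolynomial : (ℕ → ℕ) → Set
IsPolynomial f = ∃[ p ] ∀ n → f n ≡ ⟦ p ⟧ n

addₚ : Polynomial → Polynomial → Polynomial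
addₚ []      q       = q
addₚ (a ∷ p) []      = a ∷ p
addₚ (a ∷ p) (b ∷ q) = a + b ∷ addₚ p q

scaleₚ : ℕ → Polynomial → Polynomial
scaleₚ a = map (a *_)

mulₚ : Polynomial → Polynomial → Polynomial
mulₚ []      q = []
mulₚ (a ∷ p) q = addₚ (scaleₚ a q) (0 ∷ mulₚ p q)

addₚ-correct : ∀ p q n → ⟦ addₚ p q ⟧ n ≡ ⟦ p ⟧ n + ⟦ q ⟧ n
addₚ-correct []      q       n = refl
addₚ-correct (a ∷ p) []      n = sym (+-identityʳ _)
addₚ-correct (a ∷ p) (b ∷ q) n = begin
  a + b + n * ⟦ addₚ p q ⟧ n         ≡⟨ cong (λ x → a + b + n * x) (addₚ-correct p q n) ⟩
  a + b + n * (⟦ p ⟧ n + ⟦ q ⟧ n)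
    ≡⟨ solve 5 (λ a b n x y → a :+ b :+ n :* (x :+ y) := a :+ n :* x :+ (b :+ n :* y)) refl a b n _ _ ⟩
  a + n * ⟦ p ⟧ n + (b + n * ⟦ q ⟧ n)  ∎
  where open ≡-Reasoning

scaleₚ-correct : ∀ a p n → ⟦ scaleₚ a p ⟧ n ≡ a * ⟦ p ⟧ n
scaleₚ-correct a []      n = sym (*-zeroʳ a)
scaleₚ-correct a (b ∷ p) n = begin
  a * b + n * ⟦ scaleₚ a p ⟧ n  ≡⟨ cong (λ x → a * b + n * x) (scaleₚ-correct a p n) ⟩
  a * b + n * (a * ⟦ p ⟧ n)
    ≡⟨ solve 4 (λ a b n x → a :* b :+ n :* (a :* x) := a :* (b :+ n :* x)) refl a b n _ ⟩
  a * (b + n * ⟦ p ⟧ n)         ∎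
  where open ≡-Reasoning

mulₚ-correct : ∀ p q n → ⟦ mulₚ p q ⟧ n ≡ ⟦ p ⟧ n * ⟦ q ⟧ n
mulₚ-correct []      q n = refl
mulₚ-correct (a ∷ p) q n = begin
  ⟦ addₚ (scaleₚ a q) (0 ∷ mulₚ p q) ⟧ n  ≡⟨ addₚ-correct (scaleₚ a q) (0 ∷ mulₚ p q) n ⟩
  ⟦ scaleₚ a q ⟧ n + n * ⟦ mulₚ p q ⟧ n
    ≡⟨ cong₂ (λ x y → x + n * y) (scaleₚ-correct a q n) (mulₚ-correct p q n) ⟩
  a * ⟦ q ⟧ n + n * (⟦ p ⟧ n * ⟦ q ⟧ n)
    ≡⟨ solve 4 (λ a n x y → a :* y :+ n :* (x :* y) := (a :+ n :* x) :* y) refl a n _ _ ⟩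
  (a + n * ⟦ p ⟧ n) * ⟦ q ⟧ n             ∎
  where open ≡-Reasoning

constant : ∀ a → IsPolynomial λ _ → a
constant a = a ∷ [] , λ n → sym (trans (cong (a +_) (*-zeroʳ n)) (+-identityʳ a))

identity : IsPolynomial λ n → n
identity = 0 ∷ 1 ∷ [] , λ n → sym (trans (cong (λ x → n * suc x) (*-zeroʳ n)) (*-identityʳ n))

infixl 6 _⊕_
infixl 7 _⊗_

_⊕_ : ∀ {f g} → IsPolynomial f → IsPolynomial g → IsPolynomial λ n → f n + g n
(p , f≡) ⊕ (q , g≡) = addₚ p q , λ n → trans (cong₂ _+_ (f≡ n) (g≡ n)) (sym (addₚ-correct p q n))

_⊗_ : ∀ {f g} → IsPolynomial f → IsPolynomial g → IsPolynomial λ n → f n * g n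
(p , f≡) ⊗ (q , g≡) = mulₚ p q , λ n → trans (cong₂ _*_ (f≡ n) (g≡ n)) (sym (mulₚ-correct p q n))

-- Here and below the combinators copy the definition term by term, so that the function they
-- describe unfolds to the given one.
baseSize-polynomial : IsPolynomial baseSize
baseSize-polynomial =
  (constant 1 ⊕ identity ⊗ (constant 1 ⊕ (constant 1 ⊕ identity ⊗ constant 4))) ⊕
  (constant 2 ⊕ identity ⊗ constant 6)

rowsTime-polynomial : ∀ c d → IsPolynomial λ n → rowsTime n n c d
rowsTime-polynomial c d = identity ⊗
  (constant 2 ⊕ (constant 1 ⊕ (constant (cost c) ⊕ (constant 1 ⊕
    ((identity ⊗ constant (2 + cost dotBody) ⊕ constant 2) ⊕ constant (cost d)))))) ⊕ constant 2

checkTime-polynomial : IsPolynomial checkTime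
checkTime-polynomial =
  constant 1 ⊕ (constant (cost rewind) ⊕ (constant 1 ⊕ (rowsTime-polynomial loadRow codeRow ⊕
  (constant 1 ⊕ ((identity ⊗ constant (2 + cost decodeBody) ⊕ constant 2) ⊕
  (constant 1 ⊕ (constant (cost rewindOk) ⊕ (constant 1 ⊕
  (rowsTime-polynomial loadPrivates testRow ⊕ constant (cost dropPrivates))))))))))

padTime-polynomial : IsPolynomial padTime
padTime-polynomial = identity ⊗ constant (2 + cost padBody) ⊕ constant 2

tryTime-polynomial : IsPolynomial tryTime
tryTime-polynomial = constant 2 ⊕ (constant 3 ⊕ (constant 1 ⊕ (constant (cost candidate) ⊕
  (constant 1 ⊕ (padTime-polynomial ⊕ (constant 1 ⊕ (checkTime-polynomial ⊕
  constant (cost settle + 2))))))))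

gapTime-polynomial : IsPolynomial gapTime
gapTime-polynomial =
  (constant 1 ⊕ (constant (cost loadSize) ⊕ (constant 1 ⊕ (padTime-polynomial ⊕
    (constant 1 ⊕ (checkTime-polynomial ⊕ constant (1 + cost begin-enumeration))))))) ⊕
  (constant (1 + cost startSearch) ⊕
    (identity ⊗ tryTime-polynomial ⊕ (constant 3 ⊕ (constant 1 ⊕ (constant 1 ⊕ identity ⊗ constant 6)))))

sum≤ : ∀ {b} xs → All (_≤ b) xs → sum xs ≤ length xs * b
sum≤ []       []         = z≤n
sum≤ (x ∷ xs) (px ∷ pxs) = +-mono-≤ px (sum≤ xs pxs)

-- Transfer of the bounds to an arbitrary run, by determinism

module _ {n} (G : Graph n) {r : Run} (runs : program onGraph G ⇓ r) where

  open Enumeration G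
  open Listing G

  outputs-run : outputs r ≡ map label-tree sets
  outputs-run = subst (λ r → outputs r ≡ map label-tree sets)
    (⇓-deterministic (executes enumeration) runs) (prints enumeration)

  peak-run : peak r ≤ 14 * mem
  peak-run = subst (λ r → peak r ≤ 14 * mem)
    (⇓-deterministic (executes enumeration) runs) (peak≤ enumeration)

  gaps-run : All (_≤ gapTime n) (gaps r)
  gaps-run = subst (λ r → All (_≤ gapTime n) (gaps r))
    (⇓-deterministic (executes enumeration) runs)
    (first≤ enumeration ∷ All.map⁺ (gaps≤ enumeration))

  gaps-length : length (gaps r) ≡ suc (length sets)
  gaps-length = cong suc (begin
    length (map proj₂ (emitted r))  ≡⟨ length-map proj₂ (emitted r) ⟩
    length (emitted r)              ≡⟨ length-map proj₁ (emitted r) ⟨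
    length (outputs r)              ≡⟨ cong length outputs-run ⟩
    length (map label-tree sets)    ≡⟨ length-map label-tree sets ⟩
    length sets                     ∎)
    where open ≡-Reasoning

  -- There is one more gap than there are outputs; the extra one is absorbed through 10000 ^ n ≤
  -- 19332 ^ n, which accounts for the factor 2.
  time-run : time r * 10000 ^ n ≤ (gapTime n * 2) * 19332 ^ n
  time-run = begin
    time r * 10000 ^ n
      ≤⟨ *-monoˡ-≤ (10000 ^ n) (sum≤ (gaps r) gaps-run) ⟩
    length (gaps r) * gapTime n * 10000 ^ n
      ≡⟨ cong (λ k → k * gapTime n * 10000 ^ n) gaps-length ⟩
    suc (length sets) * gapTime n * 10000 ^ n
      ≡⟨ solve 3 (λ k g d → (con 1 :+ k) :* g :* d := g :* (d :+ k :* d)) refl (length sets) (gapTime n) (10000 ^ n) ⟩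
    gapTime n * (10000 ^ n + length sets * 10000 ^ n)
      ≤⟨ *-monoʳ-≤ (gapTime n) (+-mono-≤ (^-monoˡ-≤ n {10000} {19332} (≤ᵇ⇒≤ 10000 19332 _)) sets-count) ⟩
    gapTime n * (19332 ^ n + 19332 ^ n)
      ≡⟨ solve 2 (λ g c → g :* (c :+ c) := (g :* con 2) :* c) refl (gapTime n) (19332 ^ n) ⟩
    (gapTime n * 2) * 19332 ^ n
      ∎
    where open ≤-Reasoning

trace-outputs : ∀ {k} {γ : Config k} {out first gap mem} {P : Tree → Set} →
  Trace γ out first gap mem → Unique out → (∀ t → t ∈ out ⇔ P t) →
  ∃[ r ] (γ ⇓ r × Unique (outputs r) × (∀ t → t ∈ outputs r ⇔ P t))
trace-outputs {P = P} τ unique correct = result τ , executes τ ,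
  subst Unique (sym (prints τ)) unique ,
  λ t → subst (λ ts → t ∈ ts ⇔ P t) (sym (prints τ)) (correct t)

program-enumerates : EnumeratesMinimalRDFs program
program-enumerates n G =
  trace-outputs (Enumeration.enumeration G) (Listing.labels-unique G) (Listing.labels-correct G)

space-bound : ∀ {k} {A : Program k} {f} → IsPolynomial f →
  (∀ {n} (G : Graph n) {r} → A onGraph G ⇓ r → peak r ≤ f n) → PolynomialSpace A
space-bound (p , f≡) bound = p , λ n G r runs → ≤-trans (bound G runs) (≤-reflexive (f≡ n))

delay-bound : ∀ {k} {A : Program k} {f} → IsPolynomial f →
  (∀ {n} (G : Graph n) {r} → A onGraph G ⇓ r → All (_≤ f n) (gaps r)) → PolynomialDelay A
delay-bound (p , f≡) bound =
  p , λ n G r runs → All.map (λ g≤ → ≤-trans g≤ (≤-reflexive (f≡ n))) (bound G runs)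

time-bound : ∀ {k} {A : Program k} {f} {a b} → IsPolynomial f →
  (∀ {n} (G : Graph n) {r} → A onGraph G ⇓ r → time r * b ^ n ≤ f n * a ^ n) → RunsInTimeO* A a b
time-bound {a = a} (p , f≡) bound =
  p , λ n G r runs → ≤-trans (bound G runs) (*-monoˡ-≤ (a ^ n) (≤-reflexive (f≡ n)))

theorem5 : ∃[ k ] Σ[ A ∈ Program k ]
    ( EnumeratesMinimalRDFs A
    × PolynomialSpace A
    × PolynomialDelay A
    × RunsInTimeO* A 19332 10000 )
theorem5 = 13 , program , program-enumerates ,
  space-bound (constant 14 ⊗ (baseSize-polynomial ⊕ gapTime-polynomial)) peak-run ,
  delay-bound gapTime-polynomial gaps-run ,
  time-bound (gapTime-polynomial ⊗ constant 2) time-run
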